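{- Let $D=(V,A)$ be a countable digraph (multiple edges and loops allowed) with $s\neq t\in V$. Suppose that for each $v\in V$ there is a finitary matroid $\mathcal{M}_v$ on $\mathsf{in}_D(v)$ (the edges with head $v$), and let $\mathcal{M}=\bigoplus_{v\in V}\mathcal{M}_v$. Then there is a system $\mathcal{P}$ of pairwise edge-disjoint $s\rightarrow t$ paths with $A(\mathcal{P})$ independent in $\mathcal{M}$, and a set $X$ with $t\in X\subseteq V\setminus\{s\}$, such that (1) $A(\mathcal{P})\cap\mathsf{out}_D(X)=\varnothing$, and (2) $A(\mathcal{P})\cap\mathsf{in}_D(X)$ spans $\mathsf{in}_D(X)$ in $\mathcal{M}$.
   Context: Paths are finite directed paths without repeated vertices. For a set $\mathcal{P}$ of paths, $A(\mathcal{P})=\bigcup_{P\in\mathcal{P}}A(P)$. For $X\subseteq V$, $\mathsf{in}_D(X)$ is the set of edges with tail in $V\setminus X$ and head in $X$, and $\mathsf{out}_D(X)$ the set of edges with tail in $X$ and head in $V\setminus X$. A matroid is finitary if all circuits are finite. A set $S$ spans a set $T$ in $\mathcal{M}$ if $T\subseteq\mathsf{span}_{\mathcal{M}}(S)$, the closure of $S$. -}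

module Defs where

open import Level using (0ℓ)
open import Data.Nat using (ℕ)
open import Data.List using (List; []; _∷_)
open import Data.List.Membership.Propositional using () renaming (_∈_ to _∈ˡ_)
open import Data.List.Relation.Unary.Unique.Propositional using (Unique)
open import Data.Product using (Σ; ∃; _×_; _,_; proj₁)
open import Data.Sum using (_⊎_)
open import Relation.Nullary using (¬_)
open import Relation.Unary using (Pred; _∈_; _∉_; _⊆_; ∅; _∪_; _∩_; ｛_｝)
open import Relation.Binary.PropositionalEquality using (_≡_)
open import Function.Definitions using (Injective)

Countable : Set → Set
Countable X = Σ (X → ℕ) (λ f → Injective _≡_ _≡_ f)

FiniteSet : {E : Set} → Pred E 0ℓ → Set
FiniteSet {E} C = Σ (List E) (λ xs → ∀ x → x ∈ C → x ∈ˡ xs)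

module _ {E : Set} (Indep : Pred (Pred E 0ℓ) 0ℓ) where

  MaximalIndepIn : Pred E 0ℓ → Pred E 0ℓ → Set₁
  MaximalIndepIn X I =
    Indep I × I ⊆ X × (∀ J → Indep J → I ⊆ J → J ⊆ X → J ⊆ I)

  MaximalIndep : Pred E 0ℓ → Set₁
  MaximalIndep I = Indep I × (∀ J → Indep J → I ⊆ J → J ⊆ I)

  Circuit : Pred E 0ℓ → Set₁
  Circuit C = ¬ Indep C × (∀ D → D ⊆ C → ¬ Indep D → C ⊆ D)

  span : Pred E 0ℓ → Pred E _
  span S e = e ∈ S ⊎ Σ (Pred E 0ℓ) (λ C → Circuit C × e ∈ C × C ⊆ (S ∪ ｛ e ｝))

  Spans : Pred E 0ℓ → Pred E 0ℓ → Set₁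
  Spans S T = T ⊆ span S

-- (Possibly infinite) matroids, via the independence axioms
-- (I1),(I2),(I3),(IM) of Bruhn–Diestel–Kriesell–Pendavingh–Wollan.

record Matroid (E : Set) : Set₁ where
  field
    Indep : Pred (Pred E 0ℓ) 0ℓ
    I1 : Indep ∅
    I2 : ∀ {I J} → J ⊆ I → Indep I → Indep J
    I3 : ∀ {I J} → Indep I → ¬ MaximalIndep Indep I → MaximalIndep Indep J →
         Σ E (λ x → x ∈ J × x ∉ I × Indep (I ∪ ｛ x ｝))
    IM : ∀ {I X} → Indep I → I ⊆ X →
         Σ (Pred E 0ℓ) (λ J → I ⊆ J × MaximalIndepIn Indep X J)

Finitary : {E : Set} → Matroid E → Set₁
Finitary M = ∀ C → Circuit (Matroid.Indep M) C → FiniteSet C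

record Digraph : Set₁ where
  field
    V : Set
    A : Set
    tail : A → V
    head : A → V

module _ (D : Digraph) where
  open Digraph D

  InEdge : V → Set
  InEdge v = Σ A (λ e → head e ≡ v)

  inD : Pred V 0ℓ → Pred A 0ℓ
  inD X e = tail e ∉ X × head e ∈ X

  outD : Pred V 0ℓ → Pred A 0ℓ
  outD X e = tail e ∈ X × head e ∉ X

  DirectSumIndep : ((v : V) → Matroid (InEdge v)) → Pred (Pred A 0ℓ) 0ℓ
  DirectSumIndep M F = ∀ v → Matroid.Indep (M v) (λ p → F (proj₁ p))

  data IsWalk : V → List A → V → Set where
    nil  : ∀ {v} → IsWalk v [] v
    cons : ∀ {u w e es} → tail e ≡ u → IsWalk (head e) es w → IsWalk u (e ∷ es) w

  verts : V → List A → List V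
  verts u [] = u ∷ []
  verts u (e ∷ es) = u ∷ verts (head e) es

  Path : V → V → Set
  Path u w = Σ (List A) (λ es → IsWalk u es w × Unique (verts u es))

  edges : ∀ {u w} → Path u w → List A
  edges = proj₁

  ArcsOf : ∀ {u w} → Pred (Path u w) 0ℓ → Pred A 0ℓ
  ArcsOf P e = Σ (Path _ _) (λ p → p ∈ P × e ∈ˡ edges p)

  EdgeDisjoint : ∀ {u w} → Pred (Path u w) 0ℓ → Set
  EdgeDisjoint P = ∀ p q → p ∈ P → q ∈ P →
    Σ A (λ e → e ∈ˡ edges p × e ∈ˡ edges q) → edges p ≡ edges q

{-# OPTIONS --safe #-}
module Submission where

open import Defs
open import Level using (0ℓ)
open import Data.Bool using (Bool; T)
open import Data.Nat using (ℕ; zero; suc; _≤_; _⊔_; _≤′_; ≤′-refl; ≤′-step)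
open import Data.Nat.Properties using (≤⇒≤′; m≤m⊔n; m≤n⊔m)
open import Data.List using (List; []; _∷_; _++_; _∷ʳ_; map)
open import Data.List.Relation.Unary.All as All using (All; []; _∷_)
open import Data.List.Relation.Unary.All.Properties using (map⁺; ++⁺; ∷ʳ⁺; ¬Any⇒All¬)
open import Data.List.Relation.Unary.AllPairs using ([]; _∷_)
open import Data.List.Relation.Unary.Any using (here; there)
open import Data.List.Relation.Unary.Unique.Propositional using (Unique)
open import Data.List.Membership.Propositional using () renaming (_∈_ to _∈ˡ_)
open import Data.List.Membership.Propositional.Properties using (∈-map⁺)
open import Data.Product using (Σ; _×_; _,_; proj₁; proj₂)
open import Data.Sum using (_⊎_; inj₁; inj₂; map₁)
open import Data.Empty using (⊥; ⊥-elim)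
open import Data.Unit using (⊤; tt)
open import Function using (case_of_; id; _∘_)
open import Relation.Nullary using (¬_; Dec; yes; no)
open import Relation.Nullary.Decidable using (decidable-stable; isYes; toWitness; fromWitness)
open import Relation.Unary using (Pred; _∈_; _⊆_; ∅; _∪_; _∩_; _∖_; ｛_｝)
open import Relation.Binary.Construct.Closure.ReflexiveTransitive as Star using (Star; ε; _◅_; _◅◅_)
open import Relation.Binary.PropositionalEquality using (_≡_; _≢_; refl; sym; trans; subst)
open import Axiom.ExcludedMiddle using (ExcludedMiddle)

-- A web is a digraph with tokens: arcs c from which a path to t is still to be started at head c.
-- Partial solutions are waves: a flow L of edge-disjoint trails (possibly infinite) issuing from
-- tokens, independent in M, and a set Y ∋ t whose in-arcs are spanned by L and which no arc of L
-- leaves.  Contracting a maximal wave gives a loose web, all of whose waves are trivial.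
-- In a loose web any arc e can be deleted and contracted without creating a wave that misses a
-- token: an augmenting walk from the missed token would either complete that wave to one of the
-- original web, or the set of vertices it cannot reach would be one.
-- To link a token b of a loose web to t, grow a tree from head b, deleting and contracting each new
-- arc and then contracting a maximal wave, which carries every other token ahead.  If t were never
-- reached, the vertices that are neither passed by these waves nor reached by the tree would form a
-- wave that misses head b.  Doing this for all tokens in turn, starting from a maximal wave out of
-- s, gives the paths; X is the set belonging to that first wave.

-- Finitary closure operators with exchange

record Closure (E : Set) : Set₁ where
  field
    cl    : Pred E 0ℓ → Pred E 0ℓ
    ext   : ∀ {X} → X ⊆ cl X
    cut   : ∀ {X Y} → X ⊆ cl Y → cl X ⊆ cl Y
    exch  : ∀ {X e f} → cl (X ∪ ｛ e ｝) f → ¬ cl X f → cl (X ∪ ｛ f ｝) e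
    fin   : ∀ {X e} → cl X e → Σ (List E) (λ ys → All X ys × cl (_∈ˡ ys) e)

  mono : ∀ {X Y} → X ⊆ Y → cl X ⊆ cl Y
  mono X⊆Y = cut (λ x → ext (X⊆Y x))

module _ (em : ExcludedMiddle 0ℓ) where

  dne : {P : Set} → ¬ ¬ P → P
  dne = decidable-stable em

  select : {E : Set} (P : Pred E 0ℓ) (xs : List E) →
           Σ (List E) (λ ys → All P ys × (∀ {x} → x ∈ˡ xs → P x → x ∈ˡ ys))
  select P [] = [] , [] , λ ()
  select P (x ∷ xs) with select P xs | em {P x}
  ... | ys , all , inc | yes p =
    x ∷ ys , p ∷ all , λ { (here refl) _ → here refl ; (there i) q → there (inc i q) }
  ... | ys , all , inc | no ¬p =
    ys , all , λ { (here refl) q → ⊥-elim (¬p q) ; (there i) q → inc i q }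

  -- Closure and fundamental circuits of a finitary matroid

  module FinitaryMatroid {E : Set} (M : Matroid E) (finM : Finitary M) where
    open Matroid M

    MaxIn : Pred E 0ℓ → Pred E 0ℓ → Set₁
    MaxIn = MaximalIndepIn Indep

    maxIn : ∀ {I X} → MaxIn X I → ∀ {x} → X x → Indep (I ∪ ｛ x ｝) → I x
    maxIn {I} (_ , I⊆X , mx) {x} Xx ind =
      mx (I ∪ ｛ x ｝) ind inj₁ (λ { (inj₁ i) → I⊆X i ; (inj₂ refl) → Xx }) (inj₂ refl)

    -- All maximal independent subsets I, J of X have the same closure: extend I ∪ {e} to a base B
    -- and J to a base K inside J ∪ (B ∖ I); then exchange B ∖ {e} against K.
    same-span : ∀ {X I J e} → MaxIn X I → MaxIn X J →
                Indep (I ∪ ｛ e ｝) → ¬ I e → Indep (J ∪ ｛ e ｝)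
    same-span {X} {I} {J} {e} mI@(iI , I⊆X , _) mJ@(iJ , J⊆X , _) iIe ¬Ie = dne contra
      where
      contra : ¬ ¬ Indep (J ∪ ｛ e ｝)
      contra ¬iJe with IM {X = λ _ → ⊤} iIe (λ _ → tt)
      ... | B , Ie⊆B , iB , _ , maxB with IM {X = J ∪ (B ∖ I)} iJ inj₁
      ... | K , J⊆K , mK@(iK , K⊆ , _) = clash
        where
        ¬Ke : ¬ K e
        ¬Ke Ke = ¬iJe (I2 (λ { (inj₁ j) → J⊆K j ; (inj₂ refl) → Ke }) iK)

        -- If `K` could be enlarged, `I3` against the base `B` would give some `y` in `B` that can
        -- be added to `K`. If `y` is in `I`, this contradicts the maximality of `J` in `X`;
        -- otherwise it contradicts that of `K` in `J ∪ (B ∖ I)`.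
        K-base : MaximalIndep Indep K
        K-base = iK , larger
          where
          larger : ∀ K′ → Indep K′ → K ⊆ K′ → K′ ⊆ K
          larger K′ iK′ K⊆K′ {x} K′x with em {K x}
          ... | yes Kx = Kx
          ... | no ¬Kx with I3 iK (λ m → ¬Kx (proj₂ m K′ iK′ K⊆K′ K′x))
                                 (iB , λ L iL B⊆L → maxB L iL B⊆L (λ _ → tt))
          ... | y , By , ¬Ky , iKy with em {I y}
          ... | yes Iy = ⊥-elim (¬Ky (J⊆K (maxIn mJ (I⊆X Iy)
                           (I2 (λ { (inj₁ j) → inj₁ (J⊆K j) ; (inj₂ r) → inj₂ r }) iKy))))
          ... | no ¬Iy = ⊥-elim (¬Ky (maxIn mK (inj₂ (By , ¬Iy)) iKy))

        clash : ⊥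
        clash with I3 {I = B ∖ ｛ e ｝} (I2 proj₁ iB)
                      (λ m → proj₂ (proj₂ m B iB proj₁ (Ie⊆B (inj₂ refl))) refl) K-base
        ... | x , Kx , ¬B-e , iB-ex = ¬Bx (Ie⊆B (inj₁ Ix))
          where
          ¬Bx : ¬ B x
          ¬Bx Bx = ¬B-e (Bx , λ { refl → ¬Ke Kx })
          Jx : J x
          Jx with K⊆ Kx
          ... | inj₁ j = j
          ... | inj₂ (b , _) = ⊥-elim (¬Bx b)
          Ix : I x
          Ix = maxIn mI (J⊆X Jx)
            (I2 (λ { (inj₁ i) → inj₁ (Ie⊆B (inj₁ i) , λ { refl → ¬Ie i }) ; (inj₂ r) → inj₂ r }) iB-ex)

    basis-of : ∀ X → Σ (Pred E 0ℓ) (λ J → ∅ ⊆ J × MaxIn X J)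
    basis-of X = IM {X = X} I1 (λ ())

    basis : Pred E 0ℓ → Pred E 0ℓ
    basis X = proj₁ (basis-of X)

    basis-max : ∀ X → MaxIn X (basis X)
    basis-max X = proj₂ (proj₂ (basis-of X))

    -- Tested on one chosen basis rather than by circuits: quantifying over circuits would leave the
    -- lowest universe, where excluded middle is assumed.
    cl : Pred E 0ℓ → Pred E 0ℓ
    cl X e = Indep (basis X ∪ ｛ e ｝) → basis X e

    -- By `same-span` the test does not depend on the basis; `cl-max` and `max-cl` pass between the
    -- chosen basis and any other one.
    cl-max : ∀ {X I e} → MaxIn X I → (Indep (I ∪ ｛ e ｝) → I e) → cl X e
    cl-max {X} {I} {e} mI h iBe with em {basis X e}
    ... | yes b = b
    ... | no ¬b = ⊥-elim (¬b (maxIn (basis-max X)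
        (proj₁ (proj₂ mI) (h (same-span (basis-max X) mI iBe ¬b))) iBe))

    max-cl : ∀ {X I e} → MaxIn X I → cl X e → Indep (I ∪ ｛ e ｝) → I e
    max-cl {X} {I} {e} mI h iIe with em {I e}
    ... | yes i = i
    ... | no ¬i = maxIn mI (proj₁ (proj₂ (basis-max X))
        (h (same-span mI (basis-max X) iIe ¬i))) iIe

    ext : ∀ {X} → X ⊆ cl X
    ext {X} Xx = maxIn (basis-max X) Xx

    mono : ∀ {X Y} → X ⊆ Y → cl X ⊆ cl Y
    mono {X} {Y} X⊆Y {e} h
      with IM {X = Y} (proj₁ (basis-max X)) (λ b → X⊆Y (proj₁ (proj₂ (basis-max X)) b))
    ... | J , B⊆J , mJ = cl-max mJ
        (λ iJe → B⊆J (h (I2 (λ { (inj₁ b) → inj₁ (B⊆J b) ; (inj₂ r) → inj₂ r }) iJe)))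

    cut : ∀ {X Y} → X ⊆ cl Y → cl X ⊆ cl Y
    cut {X} {Y} X⊆clY {e} h = max-cl maxclY (mono X⊆clY h)
      where
      maxclY : MaxIn (cl Y) (basis Y)
      maxclY = proj₁ (basis-max Y) , (λ b → ext (proj₁ (proj₂ (basis-max Y)) b)) ,
        λ J iJ B⊆J J⊆cl j → J⊆cl j (I2 (λ { (inj₁ b) → B⊆J b ; (inj₂ refl) → j }) iJ)

    indep-max : ∀ {I} → Indep I → MaxIn I I
    indep-max iI = iI , (λ i → i) , λ J iJ I⊆J J⊆I → J⊆I

    add-max : ∀ {X I e} → MaxIn X I → Indep (I ∪ ｛ e ｝) → MaxIn (X ∪ ｛ e ｝) (I ∪ ｛ e ｝)
    add-max {X} {I} {e} mI iIe = iIe , (λ { (inj₁ i) → inj₁ (proj₁ (proj₂ mI) i) ; (inj₂ r) → inj₂ r }) , mx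
      where
      mx : ∀ J → Indep J → I ∪ ｛ e ｝ ⊆ J → J ⊆ X ∪ ｛ e ｝ → J ⊆ I ∪ ｛ e ｝
      mx J iJ Ie⊆J J⊆ {x} Jx with J⊆ Jx
      ... | inj₂ r = inj₂ r
      ... | inj₁ Xx = inj₁ (maxIn mI Xx (I2 (λ { (inj₁ i) → Ie⊆J (inj₁ i) ; (inj₂ refl) → Jx }) iJ))

    -- When neither `e` nor `f` is spanned by `X`, adding either one to the basis of `X` gives a
    -- basis of the enlarged set, and the hypothesis says that adding both is dependent, which is
    -- symmetric in `e` and `f`.
    exch : ∀ {X e f} → cl (X ∪ ｛ e ｝) f → ¬ cl X f → cl (X ∪ ｛ f ｝) e
    exch {X} {e} {f} h ¬h with em {Indep (basis X ∪ ｛ e ｝)}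
    ... | no ¬i = mono inj₁ (λ i → ⊥-elim (¬i i))
    ... | yes iBe = cl-max (add-max (basis-max X) iBf) bad
      where
      iBf : Indep (basis X ∪ ｛ f ｝)
      iBf = dne (λ ¬i → ¬h (λ i → ⊥-elim (¬i i)))
      ¬Bf : ¬ basis X f
      ¬Bf b = ¬h (λ _ → b)
      bad : Indep ((basis X ∪ ｛ f ｝) ∪ ｛ e ｝) → (basis X ∪ ｛ f ｝) e
      bad i with max-cl (add-max (basis-max X) iBe) h
                   (I2 (λ { (inj₁ (inj₁ b)) → inj₁ (inj₁ b) ; (inj₁ (inj₂ r)) → inj₂ r
                          ; (inj₂ r) → inj₁ (inj₂ r) }) i)
      ... | inj₁ b = ⊥-elim (¬Bf b)
      ... | inj₂ refl = inj₂ refl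

    indep⇒ : ∀ {F f} → Indep F → F f → ¬ cl (F ∖ ｛ f ｝) f
    indep⇒ {F} {f} iF Ff h =
      proj₂ (max-cl (indep-max (I2 proj₁ iF)) h (I2 (λ { (inj₁ x) → proj₁ x ; (inj₂ refl) → Ff }) iF)) refl

    -- An `f` in `F` outside the basis of `F` would leave this set a basis of `F ∖ ｛ f ｝` too, so
    -- `f` would be spanned by the rest.
    ⇒indep : ∀ {F} → (∀ {f} → F f → ¬ cl (F ∖ ｛ f ｝) f) → Indep F
    ⇒indep {F} h = I2 sub (proj₁ (basis-max F))
      where
      sub : F ⊆ basis F
      sub {f} Ff = dne λ ¬b →
        let mB = basis-max F
            mB′ : MaxIn (F ∖ ｛ f ｝) (basis F)
            mB′ = proj₁ mB , (λ b → proj₁ (proj₂ mB) b , λ { refl → ¬b b }) ,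
                  λ J iJ B⊆J J⊆ → proj₂ (proj₂ mB) J iJ B⊆J (λ j → proj₁ (J⊆ j))
        in h Ff (cl-max mB′ (maxIn mB Ff))

    -- For `e` outside `B` but spanned by it, this is the fundamental circuit of `e` with respect to
    -- `B`, without `e` itself.
    fundamental : Pred E 0ℓ → E → Pred E 0ℓ
    fundamental B e y = B y × ¬ cl (B ∖ ｛ y ｝) e

    module Fundamental {B e} (iB : Indep B) (¬Be : ¬ B e) (¬iBe : ¬ Indep (B ∪ ｛ e ｝)) where
      C : Pred E 0ℓ
      C = fundamental B e ∪ ｛ e ｝

      -- Extend `C` to a basis `J` of `B ∪ ｛ e ｝`. A `z` in `B` missing from `J` is outside the
      -- fundamental circuit, so `B ∖ ｛ z ｝` spans `e`, hence `J`, hence `z`, which the independence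
      -- of `B` forbids. So `J` contains the dependent set `B ∪ ｛ e ｝`.
      C-dep : ¬ Indep C
      C-dep iC with IM {X = B ∪ ｛ e ｝} iC (λ { (inj₁ c) → inj₁ (proj₁ c) ; (inj₂ r) → inj₂ r })
      ... | J , C⊆J , mJ@(iJ , J⊆ , _) = ¬iBe (I2 Be⊆J iJ)
        where
        Be⊆J : B ∪ ｛ e ｝ ⊆ J
        Be⊆J (inj₂ r) = C⊆J (inj₂ r)
        Be⊆J {z} (inj₁ Bz) = dne λ ¬Jz →
          let e∈ : cl (B ∖ ｛ z ｝) e
              e∈ = dne (λ ¬c → ¬Jz (C⊆J (inj₁ (Bz , ¬c))))
          in indep⇒ iB Bz (cut (λ j → avoid (J⊆ j) ¬Jz j e∈) (cl-max (indep-max iJ) (λ iJz → maxIn mJ (inj₁ Bz) iJz)))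
          where
          avoid : ∀ {j} → (B ∪ ｛ e ｝) j → ¬ J z → J j → cl (B ∖ ｛ z ｝) e → cl (B ∖ ｛ z ｝) j
          avoid (inj₁ Bj) ¬Jz Jj e∈ = ext (Bj , λ { refl → ¬Jz Jj })
          avoid (inj₂ refl) _ _ e∈ = e∈

      circuit : Circuit Indep C
      circuit = C-dep , λ D D⊆C ¬iD {x} Cx → dne λ ¬Dx → ¬iD (I2 (D⊆C- D⊆C ¬Dx) (drop Cx))
        where
        D⊆C- : ∀ {D x} → D ⊆ C → ¬ D x → D ⊆ C ∖ ｛ x ｝
        D⊆C- D⊆C ¬Dx Dy = D⊆C Dy , λ { refl → ¬Dx Dy }
        drop : ∀ {x} → C x → Indep (C ∖ ｛ x ｝)
        drop (inj₂ refl) = I2 (λ { (inj₁ c , _) → proj₁ c ; (inj₂ refl , n) → ⊥-elim (n refl) }) iB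
        drop {x} (inj₁ (Bx , ¬c)) = I2 sub ind
          where
          ind : Indep ((B ∖ ｛ x ｝) ∪ ｛ e ｝)
          ind = dne λ ¬i → ¬c (cl-max (indep-max (I2 proj₁ iB)) (λ i → ⊥-elim (¬i i)))
          sub : C ∖ ｛ x ｝ ⊆ (B ∖ ｛ x ｝) ∪ ｛ e ｝
          sub (inj₁ c , n) = inj₁ (proj₁ c , n)
          sub (inj₂ r , _) = inj₂ r

    cl-circuit : ∀ {S e} → cl S e → ¬ S e → Σ (Pred E 0ℓ) (λ C → Circuit Indep C × C e × C ⊆ (S ∪ ｛ e ｝))
    cl-circuit {S} {e} h ¬Se = C , circuit , inj₂ refl ,
        λ { (inj₁ c) → inj₁ (B⊆S (proj₁ c)) ; (inj₂ r) → inj₂ r }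
      where
      B⊆S = proj₁ (proj₂ (basis-max S))
      open Fundamental (proj₁ (basis-max S)) (λ b → ¬Se (B⊆S b)) (λ i → ¬Se (B⊆S (h i)))

    -- For `e` outside the basis the list consists of the other members of its fundamental circuit,
    -- finite by `finM`; `select` removes surplus entries of the enclosing list.
    fin : ∀ {X e} → cl X e → Σ (List E) (λ ys → All X ys × cl (_∈ˡ ys) e)
    fin {X} {e} h with em {basis X e}
    ... | yes b = e ∷ [] , proj₁ (proj₂ (basis-max X)) b ∷ [] , ext (here refl)
    ... | no ¬b with finM C circuit
      where open Fundamental (proj₁ (basis-max X)) ¬b (λ i → ¬b (h i))
    ... | xs , C⊆xs with select (fundamental (basis X) e) xs
    ... | ys , all , inc = ys , mapX all , mono (λ c → inc (C⊆xs _ (inj₁ c)) c)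
            (cl-max (indep-max (I2 proj₁ (proj₁ (basis-max X)))) (λ i → ⊥-elim (C-dep i)))
      where
      open Fundamental (proj₁ (basis-max X)) ¬b (λ i → ¬b (h i))
      mapX : ∀ {zs} → All (fundamental (basis X) e) zs → All X zs
      mapX [] = []
      mapX (c ∷ cs) = proj₁ (proj₂ (basis-max X)) (proj₁ c) ∷ mapX cs

    closure : Closure E
    closure = record { cl = cl ; ext = ext ; cut = cut ; exch = exch ; fin = fin }

-- Closure of the direct sum

module DirectSum (em : ExcludedMiddle 0ℓ) (D : Digraph)
               (M : (v : Digraph.V D) → Matroid (InEdge D v)) (finM : ∀ v → Finitary (M v)) where
  open Digraph D
  module Mᵥ (v : V) = FinitaryMatroid em (M v) (finM v)

  same : ∀ {v} {p q : InEdge D v} → proj₁ p ≡ proj₁ q → p ≡ q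
  same {p = x , refl} {.x , refl} refl = refl

  at : Pred A 0ℓ → (v : V) → Pred (InEdge D v) 0ℓ
  at X v p = X (proj₁ p)

  lift : (∀ v → Pred (InEdge D v) 0ℓ) → Pred A 0ℓ
  lift P e = P (head e) (e , refl)

  lift-at : ∀ {P : ∀ v → Pred (InEdge D v) 0ℓ} {v} → at (lift P) v ⊆ P v
  lift-at {x = _ , refl} p = p

  at-lift : ∀ {P : ∀ v → Pred (InEdge D v) 0ℓ} {v} → P v ⊆ at (lift P) v
  at-lift {x = _ , refl} p = p

  cl : Pred A 0ℓ → Pred A 0ℓ
  cl X = lift (λ v → Mᵥ.cl v (at X v))

  exch : ∀ {X e f} → cl (X ∪ ｛ e ｝) f → ¬ cl X f → cl (X ∪ ｛ f ｝) e
  exch {X} {e} {f} h ¬h with em {head e ≡ head f}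
  ... | no e≢f = ⊥-elim (¬h (Mᵥ.mono (head f) (λ {p} → sub {p}) h))
    where
    sub : at (X ∪ ｛ e ｝) (head f) ⊆ at X (head f)
    sub (inj₁ x) = x
    sub {_ , q} (inj₂ refl) = ⊥-elim (e≢f q)
  ... | yes e≡f = at-lift {λ v → Mᵥ.cl v (at (X ∪ ｛ f ｝) v)} {head f} {e , e≡f}
        (Mᵥ.mono (head f) (λ { (inj₁ x) → inj₁ x ; (inj₂ refl) → inj₂ refl })
          (Mᵥ.exch (head f) (Mᵥ.mono (head f) (λ {p} → sub {p}) h) ¬h))
    where
    sub : at (X ∪ ｛ e ｝) (head f) ⊆ at X (head f) ∪ ｛ (e , e≡f) ｝
    sub (inj₁ x) = inj₁ x
    sub (inj₂ r) = inj₂ (same r)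

  fin : ∀ {X e} → cl X e → Σ (List A) (λ ys → All X ys × cl (_∈ˡ ys) e)
  fin {X} {e} h with Mᵥ.fin (head e) h
  ... | ys , all , h′ = map proj₁ ys , map⁺ all , Mᵥ.mono (head e) (∈-map⁺ proj₁) h′

  closure : Closure A
  closure = record
    { cl = cl
    ; ext = λ {_} {e} x → Mᵥ.ext (head e) x
    ; cut = λ {X} {Y} X⊆ {e} → Mᵥ.cut (head e)
        (λ {p} x → lift-at {λ v → Mᵥ.cl v (at Y v)} {head e} {p} (X⊆ x))
    ; exch = exch
    ; fin = fin
    }

  -- Together with the closure axioms this is all that `Webs` uses of the matroids.
  local : ∀ {X e} → cl X e → cl (λ x → X x × head x ≡ head e) e
  local {e = e} = Mᵥ.mono (head e) (λ {p} x → x , proj₂ p)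

  basis : Pred A 0ℓ → Pred A 0ℓ
  basis X = lift (λ v → Mᵥ.basis v (at X v))

  basis⊆ : ∀ {X} → basis X ⊆ X
  basis⊆ {X} {e} b = proj₁ (proj₂ (Mᵥ.basis-max (head e) (at X (head e)))) b

  basis-indep : ∀ {X f} → basis X f → ¬ cl (basis X ∖ ｛ f ｝) f
  basis-indep {X} {f} b h = Mᵥ.indep⇒ v (proj₁ (Mᵥ.basis-max v (at X v))) b (Mᵥ.mono v sub h)
    where
    v = head f
    sub : at (basis X ∖ ｛ f ｝) v ⊆ Mᵥ.basis v (at X v) ∖ ｛ (f , refl) ｝
    sub {p} (x , n) = lift-at {λ v → Mᵥ.basis v (at X v)} {v} {p} x , λ { refl → n refl }

  ⊆cl-basis : ∀ {X} → X ⊆ cl (basis X)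
  ⊆cl-basis {X} {e} Xe = Mᵥ.mono v (λ {p} → at-lift {λ v → Mᵥ.basis v (at X v)} {v} {p})
      (Mᵥ.cl-max v (Mᵥ.indep-max v (proj₁ mB)) (Mᵥ.maxIn v mB Xe))
    where
    v = head e
    mB = Mᵥ.basis-max v (at X v)

  indep : ∀ {F} → (∀ {f} → F f → ¬ cl (F ∖ ｛ f ｝) f) → DirectSumIndep D M F
  indep {F} h v = Mᵥ.⇒indep v λ { {f , refl} Ff hf → h Ff (Mᵥ.mono v (λ { (x , n) → x , λ r → n (same r) }) hf) }

  -- A circuit at one vertex is a circuit of the sum: a set inside `C′` is empty at every other
  -- vertex, so if it is dependent, it is dependent at `v`.
  cl⇒span : ∀ {S} → cl S ⊆ span (DirectSumIndep D M) S
  cl⇒span {S} {e} h with em {S e}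
  ... | yes s = inj₁ s
  ... | no ¬s with Mᵥ.cl-circuit (head e) h ¬s
  ... | C , (¬iC , minC) , Ce , C⊆ = inj₂ (C′ , (¬iC′ , minC′) , (refl , Ce) , C′⊆)
    where
    v = head e
    C′ : Pred A 0ℓ
    C′ x = Σ (head x ≡ v) (λ q → C (x , q))
    ¬iC′ : ¬ DirectSumIndep D M C′
    ¬iC′ i = ¬iC (Matroid.I2 (M v) (λ {p} c → proj₂ p , c) (i v))
    C′⊆ : C′ ⊆ S ∪ ｛ e ｝
    C′⊆ (q , c) with C⊆ c
    ... | inj₁ s = inj₁ s
    ... | inj₂ refl = inj₂ refl
    minC′ : ∀ D′ → D′ ⊆ C′ → ¬ DirectSumIndep D M D′ → C′ ⊆ D′
    minC′ D′ D′⊆ ¬iD′ (q , c) = minC (at D′ v) (λ d → subst C (same refl) (proj₂ (D′⊆ d))) ¬i c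
      where
      ¬i : ¬ Matroid.Indep (M v) (at D′ v)
      ¬i i = ¬iD′ other
        where
        other : DirectSumIndep D M D′
        other w with em {w ≡ v}
        ... | yes refl = i
        ... | no w≢v = Matroid.I2 (M w) (λ { {x , refl} d → ⊥-elim (w≢v (proj₁ (D′⊆ d))) }) (Matroid.I1 (M w))

-- Independence in contractions

module Independence (em : ExcludedMiddle 0ℓ) {E : Set} (𝒞 : Closure E) where
  open Closure 𝒞

  -- Independence in the contraction by N.
  Ind : Pred E 0ℓ → Pred E 0ℓ → Set
  Ind N F = ∀ {f} → F f → ¬ cl (N ∪ (F ∖ ｛ f ｝)) f

  ind-anti : ∀ {N N′ F F′} → N′ ⊆ N → F′ ⊆ F → Ind N F → Ind N′ F′
  ind-anti N⊆ F⊆ i Ff h =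
    i (F⊆ Ff) (mono (λ { (inj₁ n) → inj₁ (N⊆ n) ; (inj₂ (x , ne)) → inj₂ (F⊆ x , ne) }) h)

  ind-add : ∀ {N F e} → Ind N F → ¬ cl (N ∪ F) e → Ind N (F ∪ ｛ e ｝)
  ind-add {N} {F} {e} i ¬e (inj₂ refl) h = ¬e (mono sub h)
    where
    sub : N ∪ ((F ∪ ｛ e ｝) ∖ ｛ e ｝) ⊆ N ∪ F
    sub (inj₁ n) = inj₁ n
    sub (inj₂ (inj₁ x , _)) = inj₂ x
    sub (inj₂ (inj₂ r , n)) = ⊥-elim (n r)
  ind-add {N} {F} {e} i ¬e {f} (inj₁ Ff) h = ¬e (mono back (exch (mono sub h) (i Ff)))
    where
    sub : N ∪ ((F ∪ ｛ e ｝) ∖ ｛ f ｝) ⊆ (N ∪ (F ∖ ｛ f ｝)) ∪ ｛ e ｝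
    sub (inj₁ n) = inj₁ (inj₁ n)
    sub (inj₂ (inj₁ x , n)) = inj₁ (inj₂ (x , n))
    sub (inj₂ (inj₂ r , _)) = inj₂ r
    back : (N ∪ (F ∖ ｛ f ｝)) ∪ ｛ f ｝ ⊆ N ∪ F
    back (inj₁ (inj₁ n)) = inj₁ n
    back (inj₁ (inj₂ (x , _))) = inj₂ x
    back (inj₂ refl) = inj₂ Ff

  ind-∪ : ∀ {N F G} → Ind N F → Ind (N ∪ F) G → Ind N (F ∪ G)
  ind-∪ {N} {F} {G} iF iG {f} (inj₂ Gf) h = iG Gf (mono sub h)
    where
    sub : N ∪ ((F ∪ G) ∖ ｛ f ｝) ⊆ (N ∪ F) ∪ (G ∖ ｛ f ｝)
    sub (inj₁ n) = inj₁ (inj₁ n)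
    sub (inj₂ (inj₁ x , _)) = inj₁ (inj₂ x)
    sub (inj₂ (inj₂ g , n)) = inj₂ (g , n)
  ind-∪ {N} {F} {G} iF iG {f} (inj₁ Ff) h with fin h
  ... | ys , all , h′ with select em G ys
  ... | gs , allG , inc = free gs allG (mono sub h′)
    where
    Z : Pred E 0ℓ
    Z = N ∪ (F ∖ ｛ f ｝)
    free : ∀ gs → All G gs → ¬ cl (Z ∪ (_∈ˡ gs)) f
    free [] _ c = iF Ff (mono (λ { (inj₁ z) → z ; (inj₂ ()) }) c)
    free (g ∷ gs) (Gg ∷ Ggs) c with em {g ∈ˡ gs}
    ... | yes g∈ = free gs Ggs (mono
            (λ { (inj₁ z) → inj₁ z ; (inj₂ (here refl)) → inj₂ g∈ ; (inj₂ (there i)) → inj₂ i }) c)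
    ... | no g∉ = iG Gg (mono back (exch (mono split c) (free gs Ggs)))
      where
      split : Z ∪ (_∈ˡ (g ∷ gs)) ⊆ (Z ∪ (_∈ˡ gs)) ∪ ｛ g ｝
      split (inj₁ z) = inj₁ (inj₁ z)
      split (inj₂ (here refl)) = inj₂ refl
      split (inj₂ (there i)) = inj₁ (inj₂ i)
      back : (Z ∪ (_∈ˡ gs)) ∪ ｛ f ｝ ⊆ (N ∪ F) ∪ (G ∖ ｛ g ｝)
      back (inj₁ (inj₁ (inj₁ n))) = inj₁ (inj₁ n)
      back (inj₁ (inj₁ (inj₂ (x , _)))) = inj₁ (inj₂ x)
      back (inj₁ (inj₂ i)) = inj₂ (All.lookup Ggs i , λ { refl → g∉ i })
      back (inj₂ refl) = inj₁ (inj₂ Ff)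
    sub : (_∈ˡ ys) ⊆ Z ∪ (_∈ˡ gs)
    sub i with All.lookup all i
    ... | inj₁ n = inj₁ (inj₁ n)
    ... | inj₂ (inj₁ x , n) = inj₁ (inj₂ (x , n))
    ... | inj₂ (inj₂ g , _) = inj₂ (inc i g)

  -- From a finite list of elements of `F` that together with `N ∪ G` spans `e`, drop entries until
  -- one, `z`, matters. By exchange `e` then helps to span `z`, so `F ∖ ｛ z ｝` cannot span `e`
  -- without spanning `z`.
  removable : ∀ {N F G e} → Ind N F → G ⊆ F → cl (N ∪ F) e → ¬ cl (N ∪ G) e →
              Σ E (λ g → F g × ¬ G g × ¬ cl (N ∪ (F ∖ ｛ g ｝)) e)
  removable {N} {F} {G} {e} iF G⊆F h ¬h with fin h
  ... | ys , all , h′ with select em F ys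
  ... | fs , allF , inc = search fs allF (mono sub h′)
    where
    sub : (_∈ˡ ys) ⊆ (N ∪ G) ∪ (_∈ˡ fs)
    sub i with All.lookup all i
    ... | inj₁ n = inj₁ (inj₁ n)
    ... | inj₂ x = inj₂ (inc i x)
    search : ∀ zs → All F zs → cl ((N ∪ G) ∪ (_∈ˡ zs)) e → Σ E (λ g → F g × ¬ G g × ¬ cl (N ∪ (F ∖ ｛ g ｝)) e)
    search [] _ c = ⊥-elim (¬h (mono (λ { (inj₁ z) → z ; (inj₂ ()) }) c))
    search (z ∷ zs) (Fz ∷ Fzs) c with em {cl ((N ∪ G) ∪ (_∈ˡ zs)) e}
    ... | yes c′ = search zs Fzs c′
    ... | no ¬c = z , Fz , ¬Gz , λ d → iF Fz (cut (back d) (exch (mono split c) ¬c))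
      where
      ¬Gz : ¬ G z
      ¬Gz Gz = ¬c (mono (λ { (inj₁ y) → inj₁ y ; (inj₂ (here refl)) → inj₁ (inj₂ Gz)
                           ; (inj₂ (there i)) → inj₂ i }) c)
      z∉ : ¬ z ∈ˡ zs
      z∉ z∈ = ¬c (mono (λ { (inj₁ y) → inj₁ y ; (inj₂ (here refl)) → inj₂ z∈
                          ; (inj₂ (there i)) → inj₂ i }) c)
      split : (N ∪ G) ∪ (_∈ˡ (z ∷ zs)) ⊆ ((N ∪ G) ∪ (_∈ˡ zs)) ∪ ｛ z ｝
      split (inj₁ y) = inj₁ (inj₁ y)
      split (inj₂ (here refl)) = inj₂ refl
      split (inj₂ (there i)) = inj₁ (inj₂ i)
      back : cl (N ∪ (F ∖ ｛ z ｝)) e → ((N ∪ G) ∪ (_∈ˡ zs)) ∪ ｛ e ｝ ⊆ cl (N ∪ (F ∖ ｛ z ｝))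
      back d (inj₁ (inj₁ (inj₁ n))) = ext (inj₁ n)
      back d (inj₁ (inj₁ (inj₂ g))) = ext (inj₂ (G⊆F g , λ { refl → ¬Gz g }))
      back d (inj₁ (inj₂ i)) = ext (inj₂ (All.lookup Fzs i , λ { refl → z∉ i }))
      back d (inj₂ refl) = d

  chain-mono : {F : ℕ → Pred E 0ℓ} → (∀ n → F n ⊆ F (suc n)) → ∀ {m n} → m ≤ n → F m ⊆ F n
  chain-mono {F} step m≤n = go (≤⇒≤′ m≤n)
    where
    go : ∀ {m n} → m ≤′ n → F m ⊆ F n
    go ≤′-refl x = x
    go (≤′-step p) x = step _ (go p x)

  -- A dependence involves finitely many elements, so it would already occur at one stage.
  ind-limit : ∀ {N} (F : ℕ → Pred E 0ℓ) → (∀ n → F n ⊆ F (suc n)) → (∀ n → Ind N (F n)) →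
              Ind N (λ e → Σ ℕ (λ n → F n e))
  ind-limit {N} F step iF {f} (n , Fnf) h with fin h
  ... | ys , all , h′ with bound ys all
    where
    bound : ∀ ys → All (N ∪ ((λ e → Σ ℕ (λ n → F n e)) ∖ ｛ f ｝)) ys →
            Σ ℕ (λ m → All (N ∪ (F m ∖ ｛ f ｝)) ys)
    up : ∀ {m m′ ys} → m ≤ m′ → All (N ∪ (F m ∖ ｛ f ｝)) ys → All (N ∪ (F m′ ∖ ｛ f ｝)) ys
    up le [] = []
    up le (inj₁ x ∷ as) = inj₁ x ∷ up le as
    up le (inj₂ (x , ne) ∷ as) = inj₂ (chain-mono {F} step le x , ne) ∷ up le as
    bound [] [] = 0 , []
    bound (y ∷ ys) (a ∷ as) with bound ys as | a
    ... | m , b | inj₁ x = m , inj₁ x ∷ b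
    ... | m , b | inj₂ ((k , x) , ne) = k ⊔ m , inj₂ (chain-mono {F} step (m≤m⊔n k m) x , ne) ∷ up (m≤n⊔m k m) b
  ... | m , b = iF (n ⊔ m) (chain-mono {F} step (m≤m⊔n n m) Fnf) (mono sub h′)
    where
    sub : (_∈ˡ ys) ⊆ N ∪ (F (n ⊔ m) ∖ ｛ f ｝)
    sub i with All.lookup b i
    ... | inj₁ x = inj₁ x
    ... | inj₂ (x , ne) = inj₂ (chain-mono {F} step (m≤n⊔m n m) x , ne)

-- Webs, flows and waves

module Webs (em : ExcludedMiddle 0ℓ) (D : Digraph) (countV : Countable (Digraph.V D)) (countA : Countable (Digraph.A D))
          (t : Digraph.V D) (𝒞 : Closure (Digraph.A D))
          (local : ∀ {X e} → Closure.cl 𝒞 X e →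
                   Closure.cl 𝒞 (λ x → X x × Digraph.head D x ≡ Digraph.head D e) e) where
  open Digraph D
  open Closure 𝒞
  open Independence em 𝒞

  -- The digraph with vertex set X and arcs outside N, with the matroid contracted by N;
  -- a token is an arc c whose path goes on from head c.
  record Web : Set₁ where
    field
      X : Pred V 0ℓ
      S : Pred A 0ℓ
      N : Pred A 0ℓ
  open Web

  Avail : Web → Pred A 0ℓ
  Avail Γ e = X Γ (tail e) × X Γ (head e) × ¬ N Γ e

  -- Tokens count as spent: lying in `N` they are contracted, and no flow can traverse them again.
  Valid : Web → Set
  Valid Γ = ∀ {c} → S Γ c → N Γ c × X Γ (head c)

  -- L c f says that the arc f is used immediately after c.
  Succ : Set₁
  Succ = A → A → Set

  Used : Succ → Pred A 0ℓ
  Used L f = Σ A (λ c → L c f)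

  -- The steps run against the flow: `Anc L c b` leads from `c` back to the earlier `b`.
  Anc : Succ → A → A → Set
  Anc L = Star (λ f c → L c f)

  infixl 6 _∪ˢ_
  _∪ˢ_ : Succ → Succ → Succ
  (L ∪ˢ U) c f = L c f ⊎ U c f

  -- Edge-disjoint trails that start at distinct tokens and are possibly infinite.
  record Flow (Γ : Web) (L : Succ) : Set where
    field
      link : ∀ {c f} → L c f → head c ≡ tail f
      av   : ∀ {c f} → L c f → Avail Γ f
      fun  : ∀ {c c′ f} → L c f → L c′ f → c ≡ c′
      inj  : ∀ {c f f′} → L c f → L c f′ → f ≡ f′
      root : ∀ {c f} → L c f → Σ A (λ b → S Γ b × Anc L c b)

    source : ∀ {c f} → L c f → S Γ c ⊎ Used L c
    source l with root l
    ... | b , Sb , ε = inj₁ Sb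
    ... | b , Sb , p ◅ _ = inj₂ (_ , p)

  record Wave (Γ : Web) (L : Succ) (Y : Pred V 0ℓ) : Set where
    field
      flow  : Flow Γ L
      out   : ∀ {c f} → L c f → ¬ Y (tail f)
      t∈Y   : Y t
      ind   : Ind (N Γ) (Used L)
      spans : ∀ {e} → Avail Γ e → ¬ Y (tail e) → Y (head e) → cl (N Γ ∪ Used L) e
    open Flow flow public

  -- What it takes to continue the flow `L` by one of `Γ′`. Unlike `quot` it also covers webs in
  -- which further arcs were deleted, and it composes.
  record Ahead (Γ : Web) (L : Succ) (Γ′ : Web) : Set where
    field
      X⊆  : X Γ′ ⊆ X Γ
      N⊆  : N Γ ⊆ N Γ′
      L⊆N : Used L ⊆ N Γ′
      S⊆  : S Γ′ ⊆ S Γ ∪ Used L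
      L∩X : ∀ {c f} → L c f → ¬ X Γ′ (tail f)

    avail : Avail Γ′ ⊆ Avail Γ
    avail (x , y , n) = X⊆ x , X⊆ y , n ∘ N⊆

  quot : Web → Succ → Pred V 0ℓ → Web
  quot Γ L Y = record
    { X = X Γ ∩ Y
    ; S = λ c → (S Γ c ⊎ Used L c) × Y (head c)
    ; N = N Γ ∪ Used L
    }

  quot-valid : ∀ {Γ L Y} → Valid Γ → Flow Γ L → Valid (quot Γ L Y)
  quot-valid v fl (inj₁ Sc , Yc) = inj₁ (proj₁ (v Sc)) , proj₂ (v Sc) , Yc
  quot-valid v fl (inj₂ (_ , l) , Yc) = inj₂ (_ , l) , proj₁ (proj₂ (Flow.av fl l)) , Yc

  quot-ahead : ∀ {Γ L Y} → Wave Γ L Y → Ahead Γ L (quot Γ L Y)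
  quot-ahead w = record
    { X⊆ = proj₁ ; N⊆ = inj₁ ; L⊆N = inj₂ ; S⊆ = proj₁ ; L∩X = λ l x → Wave.out w l (proj₂ x) }

  -- The two flows share no arc because `N Γ′` contains those of `L`. No arc gets two successors
  -- because a successor in `L` starts outside `X Γ′` and one in `U` starts inside.
  flow-∪ : ∀ {Γ L Γ′ U} → Flow Γ L → Ahead Γ L Γ′ → Flow Γ′ U → Flow Γ (L ∪ˢ U)
  flow-∪ {Γ} {L} {Γ′} {U} fL a fU = record
    { link = λ { (inj₁ l) → Flow.link fL l ; (inj₂ u) → Flow.link fU u }
    ; av = λ { (inj₁ l) → Flow.av fL l ; (inj₂ u) → avail (Flow.av fU u) }
    ; fun = λ { (inj₁ l) (inj₁ l′) → Flow.fun fL l l′ ; (inj₂ u) (inj₂ u′) → Flow.fun fU u u′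
              ; (inj₁ l) (inj₂ u) → ⊥-elim (apart l u) ; (inj₂ u) (inj₁ l) → ⊥-elim (apart l u) }
    ; inj = λ { (inj₁ l) (inj₁ l′) → Flow.inj fL l l′ ; (inj₂ u) (inj₂ u′) → Flow.inj fU u u′
              ; (inj₁ l) (inj₂ u) → ⊥-elim (apart′ l u) ; (inj₂ u) (inj₁ l) → ⊥-elim (apart′ l u) }
    ; root = λ { (inj₁ l) → rootL l ; (inj₂ u) → rootU u }
    }
    where
    open Ahead a
    apart : ∀ {c c′ f} → L c f → U c′ f → ⊥
    apart l u = proj₂ (proj₂ (Flow.av fU u)) (L⊆N (_ , l))
    apart′ : ∀ {c f f′} → L c f → U c f′ → ⊥
    apart′ l u = L∩X l (subst (X Γ′) (trans (sym (Flow.link fU u)) (Flow.link fL l)) (proj₁ (Flow.av fU u)))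
    rootL : ∀ {c f} → L c f → Σ A (λ b → S Γ b × Anc (L ∪ˢ U) c b)
    rootL l with Flow.root fL l
    ... | b , Sb , p = b , Sb , Star.map inj₁ p
    rootU : ∀ {c f} → U c f → Σ A (λ b → S Γ b × Anc (L ∪ˢ U) c b)
    rootU u with Flow.root fU u
    ... | b , S′b , p with S⊆ S′b
    ... | inj₁ Sb = b , Sb , Star.map inj₂ p
    ... | inj₂ (c , l) with rootL l
    ... | b′ , Sb′ , q = b′ , Sb′ , Star.map inj₂ p ◅◅ (inj₁ l ◅ q)

  -- An arc entering the intersection from outside `Y` is spanned by the first wave. One that starts
  -- in `Y` is used by `L` or survives in the quotient, where the second wave spans it.
  wave-∪ : ∀ {Γ L Y U Y′} → Wave Γ L Y → Wave (quot Γ L Y) U Y′ → Wave Γ (L ∪ˢ U) (Y ∩ Y′)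
  wave-∪ {Γ} {L} {Y} {U} {Y′} w w′ = record
    { flow = flow-∪ (Wave.flow w) (quot-ahead w) (Wave.flow w′)
    ; out = λ { (inj₁ l) y → Wave.out w l (proj₁ y) ; (inj₂ u) y → Wave.out w′ u (proj₂ y) }
    ; t∈Y = Wave.t∈Y w , Wave.t∈Y w′
    ; ind = ind-anti id (λ { (c , inj₁ l) → inj₁ (c , l) ; (c , inj₂ u) → inj₂ (c , u) })
                     (ind-∪ (Wave.ind w) (Wave.ind w′))
    ; spans = spans
    }
    where
    merge : (N Γ ∪ Used L) ∪ Used U ⊆ N Γ ∪ Used (L ∪ˢ U)
    merge (inj₁ (inj₁ n)) = inj₁ n
    merge (inj₁ (inj₂ (c , l))) = inj₂ (c , inj₁ l)
    merge (inj₂ (c , u)) = inj₂ (c , inj₂ u)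
    spans : ∀ {e} → Avail Γ e → ¬ (Y ∩ Y′) (tail e) → (Y ∩ Y′) (head e) → cl (N Γ ∪ Used (L ∪ˢ U)) e
    spans {e} (xt , xh , n) ¬y (yh , y′h) with em {Y (tail e)} | em {Used L e}
    ... | no ¬yt | _ = mono (merge ∘ inj₁) (Wave.spans w (xt , xh , n) ¬yt yh)
    ... | yes yt | yes u = ext (merge (inj₁ (inj₂ u)))
    ... | yes yt | no ¬u = mono merge (Wave.spans w′
            ((xt , yt) , (xh , yh) , λ { (inj₁ m) → n m ; (inj₂ u) → ¬u u })
            (λ y′t → ¬y (yt , y′t)) y′h)

  wave-cong : ∀ {Γ L L′ Y Y′} → (∀ {c f} → L c f → L′ c f) → (∀ {c f} → L′ c f → L c f) →
              Y ⊆ Y′ → Y′ ⊆ Y → Wave Γ L Y → Wave Γ L′ Y′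
  wave-cong {Γ} {L} {L′} to from yto yfrom w = record
    { flow = record
      { link = link ∘ from ; av = av ∘ from
      ; fun = λ l l′ → fun (from l) (from l′) ; inj = λ l l′ → inj (from l) (from l′)
      ; root = λ l → let b , Sb , p = root (from l) in b , Sb , Star.map to p }
    ; out = λ l y → out (from l) (yfrom y)
    ; t∈Y = yto t∈Y
    ; ind = ind-anti id (λ { (c , l) → c , from l }) ind
    ; spans = λ a y y′ → mono (λ { (inj₁ n) → inj₁ n ; (inj₂ (c , l)) → inj₂ (c , to l) })
                              (spans a (y ∘ yto) (yfrom y′))
    }
    where open Wave w

  wave-tokens : ∀ {Γ S′ L Y} → S′ ⊆ S Γ → Wave (record Γ { S = S′ }) L Y → Wave Γ L Y
  wave-tokens S′⊆ w = record
    { flow = record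
      { link = link ; av = av ; fun = fun ; inj = inj
      ; root = λ l → let b , Sb , p = root l in b , S′⊆ Sb , p }
    ; out = out ; t∈Y = t∈Y ; ind = ind ; spans = spans
    }
    where open Wave w

  wave-∅ : ∀ {Γ} → Wave Γ (λ _ _ → ⊥) (λ _ → ⊤)
  wave-∅ = record
    { flow = record { link = λ () ; av = λ () ; fun = λ () ; inj = λ () ; root = λ () }
    ; out = λ () ; t∈Y = tt ; ind = λ () ; spans = λ _ ¬tt → ⊥-elim (¬tt tt) }

  -- The flow of such a wave is then empty as well, since its arcs start in `X Γ` but outside `Y`.
  Loose : Web → Set₁
  Loose Γ = ∀ {L Y} → Wave Γ L Y → X Γ ⊆ Y

  loose-tokens : ∀ {Γ S′} → S′ ⊆ S Γ → Loose Γ → Loose (record Γ { S = S′ })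
  loose-tokens S′⊆ lo w = lo (wave-tokens S′⊆ w)

  -- Existence of subsets can be decided by excluded middle for Set₀ once they are Boolean-valued.
  ⌊_⌋ : {B : Set} → Pred B 0ℓ → B → Bool
  ⌊ P ⌋ x = isYes (em {P x})

  ⟦_⟧ : {B : Set} → (B → Bool) → Pred B 0ℓ
  ⟦ β ⟧ x = T (β x)

  code : {B : Set} (P : Pred B 0ℓ) → P ⊆ ⟦ ⌊ P ⌋ ⟧
  code P = fromWitness

  decode : {B : Set} (P : Pred B 0ℓ) → ⟦ ⌊ P ⌋ ⟧ ⊆ P
  decode P = toWitness

  succ-mono : (L : ℕ → Succ) → (∀ n {c f} → L n c f → L (suc n) c f) →
              ∀ {m n} → m ≤ n → ∀ {c f} → L m c f → L n c f
  succ-mono L step le {c} {f} = chain-mono {F = λ n e → L n c f} (λ n → step n) le {f}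

  flow-limit : ∀ {Γ} (L : ℕ → Succ) → (∀ n {c f} → L n c f → L (suc n) c f) →
               (∀ n → Flow Γ (L n)) → Flow Γ (λ c f → Σ ℕ (λ n → L n c f))
  flow-limit L step fl = record
    { link = λ { (n , l) → Flow.link (fl n) l }
    ; av = λ { (n , l) → Flow.av (fl n) l }
    ; fun = λ { (m , l) (n , l′) → Flow.fun (fl (m ⊔ n)) (up (m≤m⊔n m n) l) (up (m≤n⊔m m n) l′) }
    ; inj = λ { (m , l) (n , l′) → Flow.inj (fl (m ⊔ n)) (up (m≤m⊔n m n) l) (up (m≤n⊔m m n) l′) }
    ; root = λ { (n , l) → let b , Sb , p = Flow.root (fl n) l in b , Sb , Star.map (n ,_) p }
    }
    where
    up : ∀ {m n} → m ≤ n → ∀ {c f} → L m c f → L n c f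
    up = succ-mono L step

  -- Maximal waves

  module Maximal (Γ : Web) where
    State : Set₁
    State = Σ Succ λ L → Σ (Pred V 0ℓ) λ Y → Wave Γ L Y

    Extension : Succ → Pred V 0ℓ → Pred V 0ℓ → Set
    Extension L Y Z = Σ (A → A → Bool) λ l → Σ (V → Bool) λ y →
      Wave Γ (λ c → ⟦ l c ⟧) ⟦ y ⟧ × (∀ {c f} → L c f → ⟦ l c ⟧ f) × (⟦ y ⟧ ⊆ Y) ×
      Σ V (λ v → Z v × ¬ ⟦ y ⟧ v)

    coded : ℕ → Pred V 0ℓ
    coded n v = proj₁ countV v ≡ n

    step : ∀ n (σ : State) → Dec (Extension (proj₁ σ) (proj₁ (proj₂ σ)) (coded n)) → State
    step n σ (yes (l , y , w , _)) = (λ c → ⟦ l c ⟧) , ⟦ y ⟧ , w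
    step n σ (no _) = σ

    -- Stage `n` is replaced by an extension that drops the vertex coded `n`, if there is one. One
    -- turn for each vertex suffices, since whatever extends the limit extends every stage.
    stage : ℕ → State
    stage zero = (λ _ _ → ⊥) , (λ _ → ⊤) , wave-∅
    stage (suc n) = step n (stage n) em

    L : ℕ → Succ
    L n = proj₁ (stage n)
    Y : ℕ → Pred V 0ℓ
    Y n = proj₁ (proj₂ (stage n))
    W : ∀ n → Wave Γ (L n) (Y n)
    W n = proj₂ (proj₂ (stage n))

    L-step : ∀ n {c f} → L n c f → L (suc n) c f
    L-step n l with em {Extension (L n) (Y n) (coded n)}
    ... | yes (_ , _ , _ , ext-L , _) = ext-L l
    ... | no _ = l

    L∞ : Succ
    L∞ c f = Σ ℕ (λ n → L n c f)
    Y∞ : Pred V 0ℓ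
    Y∞ v = ∀ n → Y n v

    Y-step : ∀ n → Y (suc n) ⊆ Y n
    Y-step n y with em {Extension (L n) (Y n) (coded n)}
    ... | yes (_ , _ , _ , _ , sub , _) = sub y
    ... | no _ = y

    wave : Wave Γ L∞ Y∞
    wave = record
      { flow = flow-limit L L-step (λ n → Wave.flow (W n))
      ; out = λ { (n , l) y → Wave.out (W n) l (y n) }
      ; t∈Y = λ n → Wave.t∈Y (W n)
      ; ind = ind-anti id (λ { (c , n , l) → n , c , l })
                (ind-limit (λ n → Used (L n)) (λ n → λ { (c , l) → c , L-step n l }) (λ n → Wave.ind (W n)))
      ; spans = spans
      }
      where
      spans : ∀ {e} → Avail Γ e → ¬ Y∞ (tail e) → Y∞ (head e) → cl (N Γ ∪ Used L∞) e
      spans {e} a ¬y y with em {Σ ℕ (λ n → ¬ Y n (tail e))}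
      ... | yes (n , ¬yn) = mono (λ { (inj₁ m) → inj₁ m ; (inj₂ (c , l)) → inj₂ (c , n , l) })
                              (Wave.spans (W n) a ¬yn (y n))
      ... | no none = ⊥-elim (¬y (λ n → dne em (λ ¬yn → none (n , ¬yn))))

    -- A wave beyond the limit was a candidate already when the turn of `v` came; by injectivity of
    -- the coding, the vertex dropped then is `v`.
    removed : ∀ n {Z} {v} → (∀ {c f} → L∞ c f → Z c f) → (Q : Pred V 0ℓ) → Q ⊆ Y∞ → Wave Γ Z Q →
              proj₁ countV v ≡ n → ¬ Q v → ¬ Y (suc n) v
    removed n {Z} {v} L⊆ Q Q⊆ w refl ¬Qv y with em {Extension (L n) (Y n) (coded n)}
    ... | yes (_ , y′ , _ , _ , _ , u , u≡ , ¬yu) = ¬yu (subst ⟦ y′ ⟧ (sym (proj₂ countV u≡)) y)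
    ... | no none = none ((λ c → ⌊ Z c ⌋) , ⌊ Q ⌋ ,
            wave-cong (λ {c} → code (Z c)) (λ {c} → decode (Z c)) (code Q) (decode Q) w ,
            (λ {c} l → code (Z c) (L⊆ (n , l))) , (λ q → Q⊆ (decode Q q) n) , v , refl , ¬Qv ∘ decode Q)

    loose : Loose (quot Γ L∞ Y∞)
    loose {U} {Y′} w {v} (_ , yv) = dne em λ ¬y′v →
      removed (proj₁ countV v) inj₁ (Y∞ ∩ Y′) proj₁ (wave-∪ wave w) refl (¬y′v ∘ proj₂) (yv (suc (proj₁ countV v)))

  -- Deleting an arc, and local changes of a flow

  delete : Web → A → Web
  delete Γ e = record Γ { N = N Γ ∪ ｛ e ｝ }

  -- The last arc of a trail, possibly a token whose trail is still empty: a place where the flow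
  -- can be extended.
  record Spare (Γ : Web) (L : Succ) (c : A) : Set where
    field
      token : S Γ c ⊎ Used L c
      final : ∀ {f} → ¬ L c f

  module FlowMoves {Γ : Web} (valid : Valid Γ) {L : Succ} (fl : Flow Γ L) where
    open Flow fl

    token∉ : ∀ {x} → Avail Γ x → ¬ Used L x → ¬ (S Γ x ⊎ Used L x)
    token∉ (_ , _ , n) ¬u (inj₁ s) = n (proj₁ (valid s))
    token∉ _ ¬u (inj₂ u) = ¬u u

    unlinked : ∀ {x} → Avail Γ x → ¬ Used L x → ∀ {f} → ¬ L x f
    unlinked a ¬u l = token∉ a ¬u (source l)

    token-root : ∀ {c} → S Γ c ⊎ Used L c → Σ A (λ b → S Γ b × Anc L c b)
    token-root (inj₁ s) = _ , s , ε
    token-root (inj₂ (_ , l)) = let b , Sb , p = root l in b , Sb , l ◅ p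

    no-loop : ∀ {g} → ¬ L g g
    no-loop {g} l = let b , Sb , p = root l in go refl Sb p
      where
      go : ∀ {a b} → a ≡ g → S Γ b → ¬ Anc L a b
      go refl Sb ε = proj₂ (proj₂ (av l)) (proj₁ (valid Sb))
      go refl Sb (m ◅ p) = go (fun m l) Sb p

    module Extend {c x} (sp : Spare Γ L c) (ax : Avail Γ x) (tx : tail x ≡ head c) (¬ux : ¬ Used L x) where
      open Spare sp
      L⁺ : Succ
      L⁺ a f = L a f ⊎ (c ≡ a × x ≡ f)

      used⇒ : Used L⁺ ⊆ Used L ∪ ｛ x ｝
      used⇒ (a , inj₁ l) = inj₁ (a , l)
      used⇒ (a , inj₂ (_ , r)) = inj₂ r

      ⇒used : Used L ∪ ｛ x ｝ ⊆ Used L⁺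
      ⇒used (inj₁ (a , l)) = a , inj₁ l
      ⇒used (inj₂ r) = c , inj₂ (refl , r)

      flow : Flow Γ L⁺
      flow = record
        { link = λ { (inj₁ l) → link l ; (inj₂ (refl , refl)) → sym tx }
        ; av = λ { (inj₁ l) → av l ; (inj₂ (refl , refl)) → ax }
        ; fun = λ { (inj₁ l) (inj₁ l′) → fun l l′ ; (inj₁ l) (inj₂ (refl , refl)) → ⊥-elim (¬ux (_ , l))
                  ; (inj₂ (refl , refl)) (inj₁ l) → ⊥-elim (¬ux (_ , l))
                  ; (inj₂ (refl , _)) (inj₂ (refl , _)) → refl }
        ; inj = λ { (inj₁ l) (inj₁ l′) → inj l l′ ; (inj₁ l) (inj₂ (refl , refl)) → ⊥-elim (final l)
                  ; (inj₂ (refl , refl)) (inj₁ l) → ⊥-elim (final l)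
                  ; (inj₂ (_ , refl)) (inj₂ (_ , refl)) → refl }
        ; root = λ { (inj₁ l) → let b , Sb , p = root l in b , Sb , Star.map inj₁ p
                   ; (inj₂ (refl , _)) → let b , Sb , p = token-root token in b , Sb , Star.map inj₁ p }
        }

      spare : Spare Γ L⁺ x
      spare = record
        { token = inj₂ (c , inj₂ (refl , refl))
        ; final = λ { (inj₁ l) → unlinked ax ¬ux l ; (inj₂ (refl , _)) → token∉ ax ¬ux token } }

      anc⇒ : ∀ {z g} → Anc L⁺ z g → z ≢ x → Anc L z g
      anc⇒ ε _ = ε
      anc⇒ (inj₁ l ◅ p) _ = l ◅ anc⇒ p (λ { refl → unlinked ax ¬ux l })
      anc⇒ (inj₂ (_ , refl) ◅ _) z≢x = ⊥-elim (z≢x refl)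

      x-anc : ∀ {g} → Anc L⁺ x g → g ≢ x → Anc L c g
      x-anc ε g≢x = ⊥-elim (g≢x refl)
      x-anc (inj₁ l ◅ _) _ = ⊥-elim (¬ux (_ , l))
      x-anc (inj₂ (refl , _) ◅ p) _ = anc⇒ p (λ { refl → token∉ ax ¬ux token })

    -- The length is recorded so that `retract-to` can recurse on it while the flow itself changes.
    AncN : ℕ → A → A → Set
    AncN zero c g = c ≡ g
    AncN (suc n) c g = Σ A (λ p → L p c × AncN n p g)

    ancN : ∀ {c g} → Anc L c g → Σ ℕ (λ n → AncN n c g)
    ancN ε = 0 , refl
    ancN (l ◅ p) = let n , q = ancN p in suc n , _ , l , q

    module Retract {c d} (sp : Spare Γ L c) (d→c : L d c) where
      open Spare sp
      L⁻ : Succ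
      L⁻ a f = L a f × f ≢ c

      anc⇒ : ∀ {a b f} → L a f → Anc L a b → Anc L⁻ a b
      anc⇒ _ ε = ε
      anc⇒ l (m ◅ p) = (m , λ { refl → final l }) ◅ anc⇒ m p

      flow : Flow Γ L⁻
      flow = record
        { link = link ∘ proj₁ ; av = av ∘ proj₁ ; fun = λ l l′ → fun (proj₁ l) (proj₁ l′)
        ; inj = λ l l′ → inj (proj₁ l) (proj₁ l′)
        ; root = λ { (l , _) → let b , Sb , p = root l in b , Sb , anc⇒ l p }
        }

      used⇒ : Used L⁻ ⊆ Used L
      used⇒ (a , l , _) = a , l

      ⇒used : Used L ∖ ｛ c ｝ ⊆ Used L⁻
      ⇒used ((a , l) , n) = a , l , λ { refl → n refl }

      spare : Spare Γ L⁻ d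
      spare = record { token = tok (source d→c) ; final = λ { (l , n) → n (inj l d→c) } }
        where
        tok : S Γ d ⊎ Used L d → S Γ d ⊎ Used L⁻ d
        tok (inj₁ s) = inj₁ s
        tok (inj₂ u) = inj₂ (⇒used (u , λ { refl → final d→c }))

    -- Both x and g end at the same vertex; the trail through g continues from x instead.
    module Reroute {x g d} (sp : Spare Γ L x) (hx : head x ≡ head g) (d→g : L d g) (¬anc : ¬ Anc L x g) where
      open Spare sp
      L⁺ : Succ
      L⁺ a f = (L a f × a ≢ g × f ≢ g) ⊎ (x ≡ a × L g f × f ≢ g)

      used⇒ : Used L⁺ ⊆ Used L ∖ ｛ g ｝
      used⇒ (a , inj₁ (l , _ , n)) = (a , l) , n ∘ sym
      used⇒ (a , inj₂ (_ , l , n)) = (g , l) , n ∘ sym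

      ⇒used : Used L ∖ ｛ g ｝ ⊆ Used L⁺
      ⇒used ((a , l) , n) with em {a ≡ g}
      ... | yes refl = x , inj₂ (refl , l , n ∘ sym)
      ... | no a≢g = a , inj₁ (l , a≢g , n ∘ sym)

      -- As `g` is no ancestor of `x`, rerouting leaves the trail behind `x` intact; otherwise
      -- linking `x` to the successor of `g` would close a cycle.
      anc-x : ∀ {z b} → Anc L x z → Anc L z b → Anc L⁺ z b
      anc-x q ε = ε
      anc-x q (l ◅ p) = inj₁ (l , (λ { refl → ¬anc (q ◅◅ l ◅ ε) }) , (λ { refl → ¬anc q })) ◅ anc-x (q ◅◅ l ◅ ε) p

      x-root : Σ A (λ b → S Γ b × Anc L⁺ x b)
      x-root = let b , Sb , p = token-root token in b , Sb , anc-x ε p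

      re-root : ∀ {a b} → S Γ b → Anc L a b → a ≢ g → Σ A (λ b → S Γ b × Anc L⁺ a b)
      re-root Sb ε _ = _ , Sb , ε
      re-root Sb (_◅_ {j = p} l q) a≢g with em {p ≡ g}
      ... | yes refl = let b , Sb′ , q′ = x-root in b , Sb′ , inj₂ (refl , l , a≢g) ◅ q′
      ... | no p≢g = let b , Sb′ , q′ = re-root Sb q p≢g in b , Sb′ , inj₁ (l , p≢g , a≢g) ◅ q′

      flow : Flow Γ L⁺
      flow = record
        { link = λ { (inj₁ (l , _)) → link l ; (inj₂ (refl , l , _)) → trans hx (link l) }
        ; av = λ { (inj₁ (l , _)) → av l ; (inj₂ (_ , l , _)) → av l }
        ; fun = λ { (inj₁ (l , _)) (inj₁ (l′ , _)) → fun l l′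
                  ; (inj₁ (l , n , _)) (inj₂ (_ , l′ , _)) → ⊥-elim (n (fun l l′))
                  ; (inj₂ (_ , l′ , _)) (inj₁ (l , n , _)) → ⊥-elim (n (fun l l′))
                  ; (inj₂ (refl , _)) (inj₂ (refl , _)) → refl }
        ; inj = λ { (inj₁ (l , _)) (inj₁ (l′ , _)) → inj l l′
                  ; (inj₁ (l , _)) (inj₂ (refl , _)) → ⊥-elim (final l)
                  ; (inj₂ (refl , _)) (inj₁ (l , _)) → ⊥-elim (final l)
                  ; (inj₂ (_ , l , _)) (inj₂ (_ , l′ , _)) → inj l l′ }
        ; root = λ { (inj₁ (l , n , _)) → let b , Sb , p = root l in re-root Sb p n
                   ; (inj₂ (refl , _)) → x-root }
        }

      spare : Spare Γ L⁺ d
      spare = record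
        { token = tok (source d→g)
        ; final = λ { (inj₁ (l , _ , n)) → n (inj l d→g) ; (inj₂ (refl , _)) → final d→g } }
        where
        tok : S Γ d ⊎ Used L d → S Γ d ⊎ Used L⁺ d
        tok (inj₁ s) = inj₁ s
        tok (inj₂ u) = inj₂ (⇒used (u , λ { refl → no-loop d→g }))

  delete-wave : ∀ {Γ e L Y} → Wave (delete Γ e) L Y → Flow Γ L × Ind (N Γ) (Used L)
  delete-wave w =
    record { link = link ; av = λ l → let x , y , n = av l in x , y , n ∘ inj₁ ; fun = fun ; inj = inj ; root = root } ,
    ind-anti inj₁ id ind
    where open Wave w

  -- Augmenting walks in a loose web

  module Alternating {Γ : Web} (valid : Valid Γ) (loose : Loose Γ) {e : A} {L₀ : Succ} {Y : Pred V 0ℓ}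
                     (w₀ : Wave (delete Γ e) L₀ Y) {b₀ : A} (Sb₀ : S Γ b₀) (¬Yb₀ : ¬ Y (head b₀))
                     (unused : ∀ {f} → ¬ L₀ b₀ f) where
    fl₀ : Flow Γ L₀
    fl₀ = proj₁ (delete-wave w₀)

    -- The invariant of augmenting walks. By `keeps`, the arcs entering `Y` stay spanned up to the
    -- help of the deleted arc `e`, so one additional arc into `Y` can complete a wave of `Γ`.
    record Good (L : Succ) (c : A) : Set where
      field
        flow  : Flow Γ L
        ind   : Ind (N Γ) (Used L)
        spare : Spare Γ L c
        c∉Y   : ¬ Y (head c)
        out   : ∀ {c f} → L c f → ¬ Y (tail f)
        keeps : ∀ {f} → Used L₀ f → Y (head f) → cl (N Γ ∪ Used L) f

    -- One step of an augmenting walk moves the spare token c of L to c′: it may discard arcs leaving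
    -- head c′ and insert arcs leaving head c, and nothing else is needed to bound the walk's effect.
    record Move (L : Succ) (c : A) (L′ : Succ) (c′ : A) : Set where
      field
        lost  : ∀ {f} → Used L f → ¬ Used L′ f → tail f ≡ head c′
        fresh : ∀ {f} → Used L′ f → ¬ Used L f → tail f ≡ head c

    ⟪_⟫ : (A → A → Bool) → Succ
    ⟪ l ⟫ c = ⟦ l c ⟧

    coded : Succ → A → A → Bool
    coded L c = ⌊ L c ⌋

    to : ∀ L {c f} → L c f → ⟪ coded L ⟫ c f
    to L {c} = code (L c)
    from : ∀ L {c f} → ⟪ coded L ⟫ c f → L c f
    from L {c} = decode (L c)

    good-coded : ∀ {L c} → Good L c → Good ⟪ coded L ⟫ c
    good-coded {L} g = record
      { flow = record
        { link = link ∘ from L ; av = av ∘ from L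
        ; fun = λ l l′ → fun (from L l) (from L l′) ; inj = λ l l′ → inj (from L l) (from L l′)
        ; root = λ l → let b , Sb , p = root (from L l) in b , Sb , Star.map (to L) p }
      ; ind = ind-anti id (λ { (c , l) → c , from L l }) ind
      ; spare = record { token = tok token ; final = final ∘ from L }
      ; c∉Y = c∉Y
      ; out = out ∘ from L
      ; keeps = λ u y → mono (λ { (inj₁ n) → inj₁ n ; (inj₂ (c , l)) → inj₂ (c , to L l) }) (keeps u y)
      }
      where
      open Good g
      open Flow flow
      open Spare spare
      tok : ∀ {c} → S Γ c ⊎ Used L c → S Γ c ⊎ Used ⟪ coded L ⟫ c
      tok (inj₁ s) = inj₁ s
      tok (inj₂ (c , l)) = inj₂ (c , to L l)

    data Reach : (A → A → Bool) → A → Set where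
      start : Reach (coded L₀) b₀
      move  : ∀ {l c l′ c′} → Reach l c → Good ⟪ l′ ⟫ c′ → Move ⟪ l ⟫ c ⟪ l′ ⟫ c′ → Reach l′ c′

    good : ∀ {l c} → Reach l c → Good ⟪ l ⟫ c
    good start = good-coded record
      { flow = fl₀ ; ind = proj₂ (delete-wave w₀) ; spare = record { token = inj₁ Sb₀ ; final = unused }
      ; c∉Y = ¬Yb₀ ; out = Wave.out w₀ ; keeps = λ u _ → ext (inj₂ u) }
    good (move _ g _) = g

    -- The vertices to which augmenting walks from `b₀` lead. The closure properties that follow
    -- serve to make the complement the set of a wave of `Γ`.
    U : Pred V 0ℓ
    U v = Σ (A → A → Bool) λ l → Σ A λ c → Reach l c × head c ≡ v

    advance : ∀ {l c L′ c′} → Reach l c → Good L′ c′ → Move ⟪ l ⟫ c L′ c′ → Reach (coded L′) c′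
    advance {L′ = L′} r g m = move r (good-coded g) record
      { lost = λ u ¬u → lost u (λ { (c , l) → ¬u (c , to L′ l) })
      ; fresh = λ { (c , l) → fresh (c , from L′ l) } }
      where open Move m

    U∩Y : ∀ {v} → U v → ¬ Y v
    U∩Y (l , c , r , refl) = Good.c∉Y (good r)

    -- Only arcs that end at head f matter for f ∈ cl, so arcs ending outside Y can be dropped.
    keeps-outside : ∀ {F G : Pred A 0ℓ} {f} → (∀ {z} → F z → Y (head z) → G z) →
                    Y (head f) → cl (N Γ ∪ F) f → cl (N Γ ∪ G) f
    keeps-outside F⇒G Yf h = mono
      (λ { (inj₁ n , _) → inj₁ n ; (inj₂ z , q) → inj₂ (F⇒G z (subst Y (sym q) Yf)) }) (local h)

    retract : ∀ {l c d} → Reach l c → ⟪ l ⟫ d c → Σ (A → A → Bool) λ l′ → Reach l′ d ×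
              (∀ {a f} → ⟪ l ⟫ a f → f ≢ c → ⟪ l′ ⟫ a f)
    retract {l} {c} {d} r d→c = coded L⁻ , advance r g m , λ p n → to L⁻ (p , n)
      where
      open Good (good r) using (ind; spare; c∉Y; out; keeps) renaming (flow to fl)
      open FlowMoves valid fl
      open Retract spare d→c renaming (spare to spare⁻)
      g : Good L⁻ d
      g = record
        { flow = flow ; ind = ind-anti id used⇒ ind ; spare = spare⁻
        ; c∉Y = λ y → out d→c (subst Y (Flow.link fl d→c) y)
        ; out = out ∘ proj₁
        ; keeps = λ u y → keeps-outside (λ z yz → ⇒used (z , λ { refl → c∉Y yz })) y (keeps u y) }
      m : Move ⟪ l ⟫ c L⁻ d
      m = record
        { lost = λ {f} u ¬u → case em {c ≡ f} of λ
            { (yes refl) → sym (Flow.link fl d→c) ; (no c≢f) → ⊥-elim (¬u (⇒used (u , c≢f))) }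
        ; fresh = λ u ¬u → ⊥-elim (¬u (used⇒ u)) }

    -- The spare token backs up along its trail one arc at a time; once `g` is discarded, it stands
    -- at the tail of `g`.
    retract-to : ∀ n {l c g} (r : Reach l c) → FlowMoves.AncN valid (Good.flow (good r)) n c g →
                 Used ⟪ l ⟫ g → U (tail g)
    retract-to zero r refl (d , d→g) =
      let l′ , r′ , _ = retract r d→g in l′ , d , r′ , Flow.link (Good.flow (good r)) d→g
    retract-to (suc n) {l} {c} {g} r (p , p→c , q) u with em {g ≡ c}
    ... | yes refl = retract-to zero r refl u
    ... | no g≢c = let l′ , r′ , keep = retract r p→c in
          retract-to n r′ (lift {r′ = r′} keep n p→c q) (let d , d→g = u in d , keep d→g g≢c)
      where
      last : ∀ {f} → ¬ ⟪ l ⟫ c f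
      last = Spare.final (Good.spare (good r))
      lift : ∀ {l′} {r′ : Reach l′ p} → (∀ {a f} → ⟪ l ⟫ a f → f ≢ c → ⟪ l′ ⟫ a f) → ∀ n {a f} → ⟪ l ⟫ a f →
             FlowMoves.AncN valid (Good.flow (good r)) n a g → FlowMoves.AncN valid (Good.flow (good r′)) n a g
      lift keep zero _ q = q
      lift {r′ = r′} keep (suc n) l (p , m , q) = p , keep m (λ { refl → last l }) , lift {r′ = r′} keep n m q

    back : ∀ {l c g} → Reach l c → Used ⟪ l ⟫ g → Anc ⟪ l ⟫ c g → U (tail g)
    back r u q = let n , q′ = FlowMoves.ancN valid (Good.flow (good r)) q in retract-to n r q′ u

    -- If `g` lies behind `c` on the same trail, back up to it. Otherwise let the trail through `g`
    -- continue from `c` instead, which frees the predecessor of `g`.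
    closed-tail : ∀ {l c g} → Reach l c → Used ⟪ l ⟫ g → head c ≡ head g → U (tail g)
    closed-tail {l} {c} {g} r u@(d , d→g) hc with em {Anc ⟪ l ⟫ c g}
    ... | yes q = back r u q
    ... | no ¬q = coded L⁺ , d , advance r gd m , Flow.link fl d→g
      where
      open Good (good r) using (ind; spare; c∉Y; out; keeps) renaming (flow to fl)
      open FlowMoves valid fl
      open Reroute spare hc d→g ¬q renaming (spare to spare⁺)
      gd : Good L⁺ d
      gd = record
        { flow = flow ; ind = ind-anti id (proj₁ ∘ used⇒) ind ; spare = spare⁺
        ; c∉Y = λ y → out d→g (subst Y (Flow.link fl d→g) y)
        ; out = λ l → out (proj₂ (proj₁ (used⇒ (_ , l))))
        ; keeps = λ u y → keeps-outside (λ z yz → ⇒used (z , λ { refl → c∉Y (subst Y (sym hc) yz) })) y (keeps u y) }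
      m : Move ⟪ l ⟫ c L⁺ d
      m = record
        { lost = λ {f} u ¬u → case em {g ≡ f} of λ
            { (yes refl) → sym (Flow.link fl d→g) ; (no g≢f) → ⊥-elim (¬u (⇒used (u , g≢f))) }
        ; fresh = λ u ¬u → ⊥-elim (¬u (proj₁ (used⇒ u))) }

    -- Here `g` is in the fundamental circuit of `x`, so `x` can replace it without loss of span.
    -- The two have the same head by `local`: after extending by `x`, the trail through `g`
    -- continues from `x`.
    closed-swap : ∀ {l c x g} → Reach l c → Avail Γ x → tail x ≡ head c → cl (N Γ ∪ Used ⟪ l ⟫) x →
                  Used ⟪ l ⟫ g → ¬ cl (N Γ ∪ (Used ⟪ l ⟫ ∖ ｛ g ｝)) x → U (tail g)
    closed-swap {l} {c} {x} {g} r ax tx h u@(d , d→g) ¬h with em {Anc ⟪ l ⟫ c g} | em {g ≡ x}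
    ... | yes q | _ = back r u q
    ... | no ¬q | yes refl = l , c , r , sym tx
    ... | no ¬q | no g≢x = coded L⁺ , d , advance r gd m , Flow.link fl d→g
      where
      open Good (good r) using (ind; c∉Y; out; keeps) renaming (flow to fl; spare to sp)
      ¬ux : ¬ Used ⟪ l ⟫ x
      ¬ux ux = ¬h (ext (inj₂ (ux , g≢x)))
      module Ex = FlowMoves.Extend valid fl sp ax tx ¬ux
      hx : head x ≡ head g
      hx = dne em λ x≢g → ¬h (mono (λ { (inj₁ n , _) → inj₁ n
                                      ; (inj₂ z , q) → inj₂ (z , λ { refl → x≢g (sym q) }) }) (local h))
      module Re = FlowMoves.Reroute valid Ex.flow Ex.spare hx (inj₁ d→g) (λ q → ¬q (Ex.x-anc q g≢x))
      open Re using (L⁺; used⇒; ⇒used)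
      F⁺ : Used L⁺ ⊆ (Used ⟪ l ⟫ ∖ ｛ g ｝) ∪ ｛ x ｝
      F⁺ u with used⇒ u
      ... | u′ , n with Ex.used⇒ u′
      ... | inj₁ v = inj₁ (v , n)
      ... | inj₂ q = inj₂ q
      ⁺F : (Used ⟪ l ⟫ ∖ ｛ g ｝) ∪ ｛ x ｝ ⊆ Used L⁺
      ⁺F (inj₁ (v , n)) = ⇒used (Ex.⇒used (inj₁ v) , n)
      ⁺F (inj₂ refl) = ⇒used (Ex.⇒used (inj₂ refl) , g≢x)
      covers : N Γ ∪ Used ⟪ l ⟫ ⊆ cl (N Γ ∪ Used L⁺)
      covers (inj₁ n) = ext (inj₁ n)
      covers {z} (inj₂ v) with em {g ≡ z}
      ... | no g≢z = ext (inj₂ (⁺F (inj₁ (v , g≢z))))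
      ... | yes refl = mono (λ { (inj₁ (inj₁ n)) → inj₁ n ; (inj₁ (inj₂ w)) → inj₂ (⁺F (inj₁ w))
                               ; (inj₂ q) → inj₂ (⁺F (inj₂ q)) }) (exch (mono split h) ¬h)
        where
        split : N Γ ∪ Used ⟪ l ⟫ ⊆ (N Γ ∪ (Used ⟪ l ⟫ ∖ ｛ g ｝)) ∪ ｛ g ｝
        split (inj₁ n) = inj₁ (inj₁ n)
        split {z} (inj₂ w) with em {g ≡ z}
        ... | yes q = inj₂ q
        ... | no g≢z = inj₁ (inj₂ (w , g≢z))
      gd : Good L⁺ d
      gd = record
        { flow = Re.flow ; ind = ind-anti id F⁺ (ind-add (ind-anti id proj₁ ind) ¬h) ; spare = Re.spare
        ; c∉Y = λ y → out d→g (subst Y (Flow.link fl d→g) y)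
        ; out = λ {a} {f} p → outside (F⁺ (a , p))
        ; keeps = λ u y → cut covers (keeps u y) }
        where
        outside : ∀ {f} → ((Used ⟪ l ⟫ ∖ ｛ g ｝) ∪ ｛ x ｝) f → ¬ Y (tail f)
        outside (inj₁ ((_ , v) , _)) = out v
        outside (inj₂ refl) y = c∉Y (subst Y tx y)
      m : Move ⟪ l ⟫ c L⁺ d
      m = record
        { lost = λ {f} u ¬u → case em {g ≡ f} of λ
            { (yes refl) → sym (Flow.link fl d→g) ; (no g≢f) → ⊥-elim (¬u (⁺F (inj₁ (u , g≢f)))) }
        ; fresh = λ u ¬u → case F⁺ u of λ { (inj₁ (v , _)) → ⊥-elim (¬u v) ; (inj₂ refl) → tx } }

    -- Adding x would make the flow a wave for Y that exchanges e, contradicting looseness.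
    no-entry : ∀ {l c x} → Reach l c → Avail Γ x → tail x ≡ head c → Y (head x) → cl (N Γ ∪ Used ⟪ l ⟫) x
    no-entry {l} {c} {x} r ax tx Yx = dne em λ ¬h → ¬Yb₀ (loose (wave ¬h) (proj₂ (valid Sb₀)))
      where
      open Good (good r) using (ind; c∉Y; out; keeps) renaming (flow to fl; spare to sp)
      spanned : ∀ {y} → Avail Γ y → ¬ Y (tail y) → Y (head y) → cl ((N Γ ∪ Used ⟪ l ⟫) ∪ ｛ e ｝) y
      spanned {y} ay ¬t Yy with em {e ≡ y}
      ... | yes q = ext (inj₂ q)
      ... | no e≢y = cut sub (local (Wave.spans w₀ ay′ ¬t Yy))
        where
        ay′ : Avail (delete Γ e) y
        ay′ = proj₁ ay , proj₁ (proj₂ ay) , λ { (inj₁ n) → proj₂ (proj₂ ay) n ; (inj₂ q) → e≢y q }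
        sub : (λ z → ((N Γ ∪ ｛ e ｝) ∪ Used L₀) z × head z ≡ head y) ⊆ cl ((N Γ ∪ Used ⟪ l ⟫) ∪ ｛ e ｝)
        sub (inj₁ (inj₁ n) , _) = ext (inj₁ (inj₁ n))
        sub (inj₁ (inj₂ q) , _) = ext (inj₂ q)
        sub (inj₂ u , q) = mono inj₁ (keeps u (subst Y (sym q) Yy))
      wave : ¬ cl (N Γ ∪ Used ⟪ l ⟫) x → Wave Γ _ Y
      wave ¬h = record
        { flow = flow
        ; out = λ { (inj₁ l) → out l ; (inj₂ (refl , refl)) y → c∉Y (subst Y tx y) }
        ; t∈Y = Wave.t∈Y w₀
        ; ind = ind-anti id used⇒ (ind-add ind ¬h)
        ; spans = λ ay ¬t Yy → cut sub (spanned ay ¬t Yy)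
        }
        where
        open FlowMoves.Extend valid fl sp ax tx (λ u → ¬h (ext (inj₂ u)))
        split : (N Γ ∪ Used ⟪ l ⟫) ∪ ｛ x ｝ ⊆ N Γ ∪ Used L⁺
        split (inj₁ (inj₁ n)) = inj₁ n
        split (inj₁ (inj₂ u)) = inj₂ (⇒used (inj₁ u))
        split (inj₂ q) = inj₂ (⇒used (inj₂ q))
        sub : (N Γ ∪ Used ⟪ l ⟫) ∪ ｛ e ｝ ⊆ cl (N Γ ∪ Used L⁺)
        sub (inj₁ z) = ext (split (inj₁ z))
        -- `e` helps to span `x`, which the flow without it does not; by exchange `x` in turn helps
        -- to span `e`.
        sub (inj₂ refl) = mono split (exch (spanned ax (λ y → c∉Y (subst Y tx y)) Yx) ¬h)

    closed-head : ∀ {l c x} → Reach l c → Avail Γ x → tail x ≡ head c → ¬ cl (N Γ ∪ Used ⟪ l ⟫) x → U (head x)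
    closed-head {l} {c} {x} r ax tx ¬h = coded L⁺ , x , advance r gd m , refl
      where
      open Good (good r) using (ind; c∉Y; out; keeps) renaming (flow to fl; spare to sp)
      open FlowMoves.Extend valid fl sp ax tx (λ u → ¬h (ext (inj₂ u)))
      gd : Good L⁺ x
      gd = record
        { flow = flow ; ind = ind-anti id used⇒ (ind-add ind ¬h) ; spare = spare
        ; c∉Y = λ Yx → ¬h (no-entry r ax tx Yx)
        ; out = λ { (inj₁ l) → out l ; (inj₂ (refl , refl)) y → c∉Y (subst Y tx y) }
        ; keeps = λ u y → mono (λ { (inj₁ n) → inj₁ n ; (inj₂ z) → inj₂ (⇒used (inj₁ z)) }) (keeps u y) }
      m : Move ⟪ l ⟫ c L⁺ x
      m = record
        { lost = λ u ¬u → ⊥-elim (¬u (⇒used (inj₁ u)))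
        ; fresh = λ u ¬u → case used⇒ u of λ { (inj₁ v) → ⊥-elim (¬u v) ; (inj₂ refl) → tx } }

    -- By `closed-head` the whole flow spans `x`. If the arcs starting in `U` did not suffice,
    -- `removable` would yield an indispensable arc starting elsewhere, contrary to `closed-swap`.
    span-from-U : ∀ {l c x} → Reach l c → Avail Γ x → tail x ≡ head c → ¬ U (head x) →
                  cl (N Γ ∪ (λ f → Used ⟪ l ⟫ f × U (tail f))) x
    span-from-U {l} {c} {x} r ax tx ¬Ux = dne em λ ¬h′ →
      let h = dne em (λ ¬h → ¬Ux (closed-head r ax tx ¬h))
          g , ug , ¬Gg , ¬hg = removable (Good.ind (good r)) proj₁ h ¬h′
      in ¬Gg (ug , closed-swap r ax tx h ug ¬hg)

    original : ∀ {l c} → Reach l c → ∀ {f} → Used L₀ f → Used ⟪ l ⟫ f ⊎ U (tail f)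
    original start (c , l) = inj₁ (c , to L₀ l)
    original (move {l′ = l′} {c′} r g m) {f} u with original r u
    ... | inj₂ q = inj₂ q
    ... | inj₁ v with em {Used ⟪ l′ ⟫ f}
    ... | yes v′ = inj₁ v′
    ... | no ¬v′ = inj₂ (l′ , c′ , move r g m , sym (Move.lost m v ¬v′))

    G : Pred A 0ℓ
    G f = Used L₀ f × U (tail f)

    -- Mutual induction on the walk, tracing inserted arcs back to `L₀`: an arc fresh in the last
    -- move leaves the previous position of the token, so the previous flow spans it by arcs that
    -- start in `U`.
    spanned-by-G : ∀ {l c} → Reach l c → ∀ {f} → Used ⟪ l ⟫ f → U (tail f) → ¬ U (head f) → cl (N Γ ∪ G) f
    spanned-at : ∀ {l c x} → Reach l c → Avail Γ x → tail x ≡ head c → ¬ U (head x) → cl (N Γ ∪ G) x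
    spanned-by-G start (c , l) Ut _ = ext (inj₂ ((c , from L₀ l) , Ut))
    spanned-by-G (move {l = l} r g m) {f} u Ut ¬Uh with em {Used ⟪ l ⟫ f}
    ... | yes v = spanned-by-G r v Ut ¬Uh
    ... | no ¬v = spanned-at r (Flow.av (Good.flow g) (proj₂ u)) (Move.fresh m u ¬v) ¬Uh
    spanned-at {l} {x = x} r ax tx ¬Ux = cut sub (local (span-from-U r ax tx ¬Ux))
      where
      sub : (λ z → (N Γ ∪ (λ f → Used ⟪ l ⟫ f × U (tail f))) z × head z ≡ head x) ⊆ cl (N Γ ∪ G)
      sub (inj₁ n , _) = ext (inj₁ n)
      sub (inj₂ (u , Ut) , q) = spanned-by-G r u Ut (λ Uz → ¬Ux (subst U q Uz))

    -- Keeps the trails of `L*` rooted: tracing back from a vertex of `U` never leaves `U`.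
    U-closed : ∀ {f} → Used L₀ f → U (head f) → U (tail f)
    U-closed u (l , c , r , hc) with original r u
    ... | inj₂ q = q
    ... | inj₁ v = closed-tail r v hc

    L* : Succ
    L* c f = L₀ c f × U (tail f)

    wave* : Wave Γ L* (λ v → ¬ U v)
    wave* = record
      { flow = record
        { link = link ∘ proj₁ ; av = av ∘ proj₁ ; fun = λ l l′ → fun (proj₁ l) (proj₁ l′)
        ; inj = λ l l′ → inj (proj₁ l) (proj₁ l′)
        ; root = λ { (l , u) → let b , Sb , p = root l in b , Sb , within p (subst U (sym (link l)) u) } }
      ; out = λ l ¬u → ¬u (proj₂ l)
      ; t∈Y = λ u → U∩Y u (Wave.t∈Y w₀)
      ; ind = ind-anti id (λ { (c , l , _) → c , l }) (proj₂ (delete-wave w₀))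
      ; spans = λ a ¬¬u ¬u → let l , c , r , q = dne em ¬¬u in
          mono (λ { (inj₁ n) → inj₁ n ; (inj₂ ((c , l) , u)) → inj₂ (c , l , u) }) (spanned-at r a (sym q) ¬u)
      }
      where
      open Flow fl₀
      within : ∀ {a b} → Anc L₀ a b → U (head a) → Anc L* a b
      within ε _ = ε
      within (l ◅ p) u = let u′ = U-closed (_ , l) u in (l , u′) ◅ within p (subst U (sym (link l)) u′)

    absurd : ⊥
    absurd = loose wave* (proj₂ (valid Sb₀)) (coded L₀ , b₀ , start , refl)

  -- Waves after deletion carry every token

  Unhindered : Web → Set₁
  Unhindered Γ = ∀ {L Y} → Wave Γ L Y → ∀ {b} → S Γ b → ¬ Y (head b) →
                 Σ A (λ f → Used L f × Y (head f) × Anc L f b)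

  delete-unhindered : ∀ {Γ e} → Valid Γ → Loose Γ → Unhindered (delete Γ e)
  delete-unhindered {Γ} {e} valid loose {L} {Y} w {b} Sb ¬Yb = dne em λ none →
    Alternating.absurd valid loose (pruned none) Sb ¬Yb (λ { (_ , ¬a) → ¬a ε })
    where
    open Wave w
    P : Succ
    P c f = L c f × ¬ Anc L c b
    pruned : ¬ Σ A (λ f → Used L f × Y (head f) × Anc L f b) → Wave (delete Γ e) P Y
    pruned none = record
      { flow = record
        { link = link ∘ proj₁ ; av = av ∘ proj₁ ; fun = λ l l′ → fun (proj₁ l) (proj₁ l′)
        ; inj = λ l l′ → inj (proj₁ l) (proj₁ l′)
        ; root = λ { (l , n) → let r , Sr , p = root l in r , Sr , keep n p } }
      ; out = out ∘ proj₁
      ; t∈Y = t∈Y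
      ; ind = ind-anti id (λ { (c , l , _) → c , l }) ind
      ; spans = λ {x} a ¬t Yh → mono (λ { (inj₁ n , _) → inj₁ n
            ; (inj₂ (c , l) , q) → inj₂ (c , l , λ p → none (_ , (c , l) , subst Y (sym q) Yh , l ◅ p)) })
            (local (spans a ¬t Yh))
      }
      where
      keep : ∀ {c r} → ¬ Anc L c b → Anc L c r → Anc P c r
      keep n ε = ε
      keep n (l ◅ p) = (l , λ q → n (l ◅ q)) ◅ keep (λ q → n (l ◅ q)) p

  -- Linking one token by a growing tree

  walk-++ : ∀ {u v w es fs} → IsWalk D u es v → IsWalk D v fs w → IsWalk D u (es ++ fs) w
  walk-++ nil q = q
  walk-++ (cons h p) q = cons h (walk-++ p q)

  walk-∷ʳ : ∀ {u es e} → IsWalk D u es (tail e) → IsWalk D u (es ∷ʳ e) (head e)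
  walk-∷ʳ p = walk-++ p (cons refl nil)

  ahead-∪ : ∀ {Γ L Γ′ U Γ″} → Ahead Γ L Γ′ → Ahead Γ′ U Γ″ → Ahead Γ (L ∪ˢ U) Γ″
  ahead-∪ {Γ} {L} {Γ′} {U} {Γ″} a a′ = record
    { X⊆ = X⊆ a ∘ X⊆ a′
    ; N⊆ = N⊆ a′ ∘ N⊆ a
    ; L⊆N = λ { (c , inj₁ l) → N⊆ a′ (L⊆N a (c , l)) ; (c , inj₂ u) → L⊆N a′ (c , u) }
    ; S⊆ = tokens
    ; L∩X = λ { (inj₁ l) x → L∩X a l (X⊆ a′ x) ; (inj₂ u) x → L∩X a′ u x }
    }
    where
    open Ahead
    tokens : S Γ″ ⊆ S Γ ∪ Used (L ∪ˢ U)
    tokens s with S⊆ a′ s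
    ... | inj₂ (c , u) = inj₂ (c , inj₂ u)
    ... | inj₁ s′ with S⊆ a s′
    ... | inj₁ s″ = inj₁ s″
    ... | inj₂ (c , l) = inj₂ (c , inj₁ l)

  record Linked (Γ : Web) (b : A) : Set₁ where
    field
      Γ′    : Web
      L     : Succ
      Q     : Pred A 0ℓ
      flow  : Flow Γ L
      ahead : Ahead Γ L Γ′
      valid : Valid Γ′
      t∈X   : X Γ′ t
      loose : Loose Γ′
      Q⊆N   : Q ⊆ N Γ′
      Q-new : ∀ {e} → Q e → Avail Γ e × ¬ Used L e
      ind   : Ind (N Γ) (Used L ∪ Q)
      carry : ∀ {c} → S Γ c → b ≢ c → Σ A (λ c′ → S Γ′ c′ × Anc L c′ c)
      path  : List A
      walk  : IsWalk D (head b) path t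
      path⊆ : All Q path

  module Tree {Γ : Web} (validΓ : Valid Γ) (looseΓ : Loose Γ) (t∈XΓ : X Γ t) {b : A} (Sb : S Γ b) where
    Γ₀ : Web
    Γ₀ = record Γ { S = S Γ ∖ ｛ b ｝ }

    Reached : Pred A 0ℓ → Pred V 0ℓ
    Reached Q u = Σ (List A) λ p → IsWalk D (head b) p u × All Q p

    reached-mono : ∀ {Q Q′} → Q ⊆ Q′ → Reached Q ⊆ Reached Q′
    reached-mono Q⊆ (p , w , all) = p , w , All.map Q⊆ all

    reached-head : ∀ {Q e} → Q e → Reached Q (tail e) → Reached Q (head e)
    reached-head Qe (p , w , all) = p ∷ʳ _ , walk-∷ʳ w , ∷ʳ⁺ all Qe

    -- The invariant of the growing tree `Q`. Its `spans` is a wave condition in which the tree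
    -- arcs, lying in `N`, may help to span; `limit-wave` eliminates them.
    record State : Set₁ where
      field
        Γ′    : Web
        L     : Succ
        Q     : Pred A 0ℓ
        flow  : Flow Γ₀ L
        ahead : Ahead Γ₀ L Γ′
        valid : Valid Γ′
        t∈X   : X Γ′ t
        loose : Loose Γ′
        Q⊆N   : Q ⊆ N Γ′
        Q-new : ∀ {e} → Q e → Avail Γ e × ¬ Used L e
        Q-end : ∀ {e} → Q e → Reached Q (head e)
        N-split : N Γ′ ⊆ N Γ ∪ Used L ∪ Q
        ind   : Ind (N Γ) (Used L ∪ Q)
        spans : ∀ {e} → Avail Γ e → ¬ X Γ′ (tail e) → X Γ′ (head e) → cl (N Γ′) e
        carry : ∀ {c} → S Γ c → b ≢ c → Σ A (λ c′ → S Γ′ c′ × Anc L c′ c)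
    open State

    initial : State
    initial = record
      { Γ′ = Γ₀ ; L = λ _ _ → ⊥ ; Q = λ _ → ⊥
      ; flow = Wave.flow wave-∅
      ; ahead = record { X⊆ = id ; N⊆ = id ; L⊆N = λ () ; S⊆ = inj₁ ; L∩X = λ () }
      ; valid = λ s → validΓ (proj₁ s)
      ; t∈X = t∈XΓ
      ; loose = loose-tokens {Γ} proj₁ looseΓ
      ; Q⊆N = λ () ; Q-new = λ () ; Q-end = λ () ; N-split = inj₁
      ; ind = λ { (inj₁ ()) ; (inj₂ ()) }
      ; spans = λ { (xt , _) ¬xt _ → ⊥-elim (¬xt xt) }
      ; carry = λ s n → _ , (s , n) , ε
      }

    Growable : State → A → Set
    Growable τ e = Reached (Q τ) (tail e) × Avail (Γ′ τ) e × ¬ cl (N (Γ′ τ)) e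

    module Grow (τ : State) {e : A} (gr : Growable τ e) where
      Γ⁻ : Web
      Γ⁻ = delete (Γ′ τ) e
      module Max = Maximal Γ⁻
      U : Succ
      U = Max.L∞
      module W = Wave Max.wave
      Γ⁺ : Web
      Γ⁺ = quot Γ⁻ U Max.Y∞

      ahead⁺ : Ahead (Γ′ τ) U Γ⁺
      ahead⁺ = record { X⊆ = X⊆ ; N⊆ = N⊆ ∘ inj₁ ; L⊆N = L⊆N ; S⊆ = S⊆ ; L∩X = L∩X }
        where open Ahead (quot-ahead {Γ⁻} Max.wave) using (X⊆; N⊆; L⊆N; S⊆; L∩X)

      valid⁻ : Valid Γ⁻
      valid⁻ s = let n , x = valid τ s in inj₁ n , x

      e∉L : ¬ Used (L τ) e
      e∉L u = proj₂ (proj₂ (proj₁ (proj₂ gr))) (Ahead.L⊆N (ahead τ) u)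

      grown : State
      grown = record
        { Γ′ = Γ⁺ ; L = L τ ∪ˢ U ; Q = Q τ ∪ ｛ e ｝
        ; flow = flow-∪ (flow τ) (ahead τ) (proj₁ (delete-wave {Γ′ τ} Max.wave))
        ; ahead = ahead-∪ (ahead τ) ahead⁺
        ; valid = quot-valid {Γ⁻} {U} {Max.Y∞} valid⁻ W.flow
        ; t∈X = t∈X τ , W.t∈Y
        ; loose = Max.loose
        ; Q⊆N = λ { (inj₁ q) → inj₁ (inj₁ (Q⊆N τ q)) ; (inj₂ r) → inj₁ (inj₂ r) }
        ; Q-new = new
        ; Q-end = λ { (inj₁ q) → reached-mono inj₁ (Q-end τ q)
                    ; (inj₂ refl) → reached-head (inj₂ refl) (reached-mono inj₁ (proj₁ gr)) }
        ; N-split = N-split⁺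
        ; ind = ind-anti id split (ind-∪ (ind-add (ind τ) ¬e) (ind-anti base id W.ind))
        ; spans = spans⁺
        ; carry = carry⁺
        }
        where
        new : ∀ {x} → (Q τ ∪ ｛ e ｝) x → Avail Γ x × ¬ Used (L τ ∪ˢ U) x
        new (inj₁ q) = proj₁ (Q-new τ q) ,
          λ { (c , inj₁ l) → proj₂ (Q-new τ q) (c , l) ; (c , inj₂ u) → proj₂ (proj₂ (W.av u)) (inj₁ (Q⊆N τ q)) }
        new (inj₂ refl) = Ahead.avail (ahead τ) (proj₁ (proj₂ gr)) ,
          λ { (c , inj₁ l) → e∉L (c , l) ; (c , inj₂ u) → proj₂ (proj₂ (W.av u)) (inj₂ refl) }
        N-split⁺ : N Γ⁺ ⊆ N Γ ∪ Used (L τ ∪ˢ U) ∪ (Q τ ∪ ｛ e ｝)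
        N-split⁺ (inj₂ (c , u)) = inj₂ (inj₁ (c , inj₂ u))
        N-split⁺ (inj₁ (inj₂ r)) = inj₂ (inj₂ (inj₂ r))
        N-split⁺ (inj₁ (inj₁ n)) with N-split τ n
        ... | inj₁ m = inj₁ m
        ... | inj₂ (inj₁ (c , l)) = inj₂ (inj₁ (c , inj₁ l))
        ... | inj₂ (inj₂ q) = inj₂ (inj₂ (inj₁ q))
        old : N Γ ∪ (Used (L τ) ∪ Q τ) ⊆ N (Γ′ τ)
        old (inj₁ n) = Ahead.N⊆ (ahead τ) n
        old (inj₂ (inj₁ u)) = Ahead.L⊆N (ahead τ) u
        old (inj₂ (inj₂ q)) = Q⊆N τ q
        ¬e : ¬ cl (N Γ ∪ (Used (L τ) ∪ Q τ)) e
        ¬e h = proj₂ (proj₂ gr) (mono old h)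
        base : N Γ ∪ ((Used (L τ) ∪ Q τ) ∪ ｛ e ｝) ⊆ N Γ⁻
        base (inj₁ n) = inj₁ (old (inj₁ n))
        base (inj₂ (inj₁ x)) = inj₁ (old (inj₂ x))
        base (inj₂ (inj₂ r)) = inj₂ r
        split : Used (L τ ∪ˢ U) ∪ (Q τ ∪ ｛ e ｝) ⊆ ((Used (L τ) ∪ Q τ) ∪ ｛ e ｝) ∪ Used U
        split (inj₁ (c , inj₁ l)) = inj₁ (inj₁ (inj₁ (c , l)))
        split (inj₁ (c , inj₂ u)) = inj₂ (c , u)
        split (inj₂ (inj₁ q)) = inj₁ (inj₁ (inj₂ q))
        split (inj₂ (inj₂ r)) = inj₁ (inj₂ r)
        spans⁺ : ∀ {x} → Avail Γ x → ¬ X Γ⁺ (tail x) → X Γ⁺ (head x) → cl (N Γ⁺) x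
        spans⁺ {x} a ¬x (xh , yh) with em {X (Γ′ τ) (tail x)} | em {N Γ⁻ x}
        ... | no ¬xt | _ = mono (inj₁ ∘ inj₁) (spans τ a ¬xt xh)
        ... | yes xt | yes n = ext (inj₁ n)
        ... | yes xt | no ¬n = W.spans (xt , xh , ¬n) (λ y → ¬x (xt , y)) yh
        carry⁺ : ∀ {c} → S Γ c → b ≢ c → Σ A (λ c′ → S Γ⁺ c′ × Anc (L τ ∪ˢ U) c′ c)
        carry⁺ s n with carry τ s n
        ... | c′ , s′ , p with em {Max.Y∞ (head c′)}
        ... | yes y = c′ , (inj₁ s′ , y) , Star.map inj₁ p
        -- The web before deleting `e` was loose, so the token missed by the new wave is carried
        -- along its own trail to an arc entering the new set.
        ... | no ¬y with delete-unhindered (valid τ) (loose τ) Max.wave s′ ¬y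
        ... | f , u , y , q = f , (inj₂ u , y) , Star.map inj₂ q ◅◅ Star.map inj₁ p

    record _≼_ (σ τ : State) : Set where
      field
        L≼ : ∀ {c f} → L σ c f → L τ c f
        Q≼ : Q σ ⊆ Q τ
        X≽ : X (Γ′ τ) ⊆ X (Γ′ σ)
    open _≼_

    ≼-refl : ∀ {τ} → τ ≼ τ
    ≼-refl = record { L≼ = id ; Q≼ = id ; X≽ = id }

    ≼-trans : ∀ {ρ σ τ} → ρ ≼ σ → σ ≼ τ → ρ ≼ τ
    ≼-trans p q = record { L≼ = L≼ q ∘ L≼ p ; Q≼ = Q≼ q ∘ Q≼ p ; X≽ = X≽ p ∘ X≽ q }

    Candidate : ℕ → State → Set
    Candidate k τ = Σ A λ e → proj₁ countA e ≡ k × Growable τ e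

    try-with : ∀ {k} τ → Dec (Candidate k τ) → State
    try-with τ (yes (e , _ , gr)) = Grow.grown τ gr
    try-with τ (no _) = τ

    try : ℕ → State → State
    try k τ = try-with τ (em {Candidate k τ})

    try-≼ : ∀ k τ → τ ≼ try k τ
    try-≼ k τ with em {Candidate k τ}
    ... | yes (e , _ , gr) = record { L≼ = inj₁ ; Q≼ = inj₁ ; X≽ = proj₁ }
    ... | no _ = ≼-refl

    try-grows : ∀ τ {e} → Growable τ e → Reached (Q (try (proj₁ countA e) τ)) (head e)
    try-grows τ {e} gr with em {Candidate (proj₁ countA e) τ}
    ... | no none = ⊥-elim (none (e , refl , gr))
    ... | yes (e′ , eq , gr′) with proj₂ countA eq
    ... | refl = Q-end (Grow.grown τ gr′) (inj₂ refl)

    sweep : ℕ → State → State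
    sweep zero τ = try zero τ
    sweep (suc k) τ = try (suc k) (sweep k τ)

    sweep-≼ : ∀ n τ → τ ≼ sweep n τ
    sweep-≼ zero τ = try-≼ zero τ
    sweep-≼ (suc n) τ = ≼-trans (sweep-≼ n τ) (try-≼ (suc n) (sweep n τ))

    sweep-tries : ∀ {k n} → k ≤′ n → ∀ τ → Σ State λ σ → τ ≼ σ × try k σ ≼ sweep n τ
    sweep-tries {zero} ≤′-refl τ = τ , ≼-refl , ≼-refl
    sweep-tries {suc k} ≤′-refl τ = sweep k τ , sweep-≼ k τ , ≼-refl
    sweep-tries (≤′-step {n = n} p) τ =
      let σ , q , r = sweep-tries p τ in σ , q , ≼-trans r (try-≼ (suc n) (sweep n τ))

    -- Stage suc n tries all arcs with codes up to n, so that each arc is tried at almost every stage.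
    stage : ℕ → State
    stage zero = initial
    stage (suc n) = sweep n (stage n)

    stage-≼ : ∀ {m n} → m ≤′ n → stage m ≼ stage n
    stage-≼ ≤′-refl = ≼-refl
    stage-≼ (≤′-step {n = n} p) = ≼-trans (stage-≼ p) (sweep-≼ n (stage n))

    L∞ : Succ
    L∞ c f = Σ ℕ λ n → L (stage n) c f

    Reached∞ : Pred V 0ℓ
    Reached∞ v = Σ ℕ λ n → Reached (Q (stage n)) v

    Z : Pred V 0ℓ
    Z v = (∀ n → X (Γ′ (stage n)) v) × ¬ Reached∞ v

    -- An arc entering `Z` starts either at a vertex passed by some wave, where `spans` of that
    -- stage applies, or at a reached vertex that is never passed. In the latter case it was tried,
    -- and had it not been spanned, the tree would have reached its head.
    limit-wave : ¬ Reached∞ t → Wave Γ₀ L∞ Z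
    limit-wave ¬t = record
      { flow = flow-limit (λ n → L (stage n)) (λ n → L≼ (sweep-≼ n (stage n))) (λ n → flow (stage n))
      ; out = λ { (n , l) z → Ahead.L∩X (ahead (stage n)) l (proj₁ z n) }
      ; t∈Y = (λ n → t∈X (stage n)) , ¬t
      ; ind = ind-anti id (λ { (c , n , l) → n , c , l })
          (ind-limit (λ n → Used (L (stage n))) (λ { n (c , l) → c , L≼ (sweep-≼ n (stage n)) l })
            (λ n → ind-anti id inj₁ (ind (stage n))))
      ; spans = spans∞
      }
      where
      by-flow : ∀ {x} n τ → τ ≼ stage n → ¬ Reached∞ (head x) → cl (N (Γ′ τ)) x → cl (N Γ ∪ Used L∞) x
      by-flow {x} n τ τ≼ ¬r h = mono sub (local h)
        where
        sub : (λ z → N (Γ′ τ) z × head z ≡ head x) ⊆ N Γ ∪ Used L∞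
        sub (z∈ , q) with N-split τ z∈
        ... | inj₁ m = inj₁ m
        ... | inj₂ (inj₁ (c , l)) = inj₂ (c , n , L≼ τ≼ l)
        -- A tree arc ends at a reached vertex, but `head x` is not reached, so by `local` no tree
        -- arc helps to span `x`.
        ... | inj₂ (inj₂ z∈Q) = ⊥-elim (¬r (n , subst (Reached (Q (stage n))) q
                (reached-mono (Q≼ τ≼) (Q-end τ z∈Q))))
      spans∞ : ∀ {x} → Avail Γ x → ¬ Z (tail x) → Z (head x) → cl (N Γ ∪ Used L∞) x
      spans∞ {x} a ¬z (xh , ¬r) with em {Σ ℕ λ n → ¬ X (Γ′ (stage n)) (tail x)}
      ... | yes (n , ¬xt) = by-flow n (stage n) ≼-refl ¬r (spans (stage n) a ¬xt (xh n))
      ... | no none = by-flow (suc n) σ σ≼ ¬r spanned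
        where
        xt : ∀ n → X (Γ′ (stage n)) (tail x)
        xt n = dne em (λ ¬x → none (n , ¬x))
        reached : Reached∞ (tail x)
        reached = dne em (λ ¬r → ¬z (xt , ¬r))
        k m n : ℕ
        k = proj₁ countA x
        m = proj₁ reached
        -- Large enough for `sweep n` to try the code of `x` and for `tail x` to be reached before
        -- it starts.
        n = k ⊔ m
        tried : Σ State λ σ → stage n ≼ σ × try k σ ≼ stage (suc n)
        tried = sweep-tries (≤⇒≤′ (m≤m⊔n k m)) (stage n)
        σ : State
        σ = proj₁ tried
        σ≼ : σ ≼ stage (suc n)
        σ≼ = ≼-trans (try-≼ k σ) (proj₂ (proj₂ tried))
        spanned : cl (N (Γ′ σ)) x
        spanned = dne em λ ¬h → ¬r (suc n , reached-mono (Q≼ (proj₂ (proj₂ tried))) (try-grows σ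
          ( reached-mono (Q≼ (≼-trans (stage-≼ (≤⇒≤′ (m≤n⊔m k m))) (proj₁ (proj₂ tried)))) (proj₂ reached)
          , (X≽ σ≼ (xt (suc n)) , X≽ σ≼ (xh (suc n)) , ¬h ∘ ext)
          , ¬h)))

    t-reached : Reached∞ t
    t-reached = dne em λ ¬t →
      proj₂ (loose-tokens {Γ} proj₁ looseΓ (limit-wave ¬t) (proj₂ (validΓ Sb))) (0 , [] , nil , [])

    linked : Linked Γ b
    linked = record
      { Γ′ = Γ′ τ ; L = L τ ; Q = Q τ
      ; flow = record
        { link = link ; av = av ; fun = fun ; inj = inj
        ; root = λ l → let r , s , p = root l in r , proj₁ s , p }
      ; ahead = record { X⊆ = X⊆ ; N⊆ = N⊆′ ; L⊆N = L⊆N ; S⊆ = λ s → map₁ proj₁ (S⊆ s) ; L∩X = L∩X }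
      ; valid = valid τ ; t∈X = t∈X τ ; loose = loose τ
      ; Q⊆N = Q⊆N τ ; Q-new = Q-new τ ; ind = ind τ ; carry = carry τ
      ; path = proj₁ r ; walk = proj₁ (proj₂ r) ; path⊆ = proj₂ (proj₂ r)
      }
      where
      τ : State
      τ = stage (proj₁ t-reached)
      r : Reached (Q τ) t
      r = proj₂ t-reached
      open Flow (flow τ)
      open Ahead (ahead τ) renaming (N⊆ to N⊆′)

  -- Linking all tokens in turn

  roots-agree : ∀ {Γ L e b b′} → Valid Γ → Flow Γ L → S Γ b → S Γ b′ → Anc L e b → Anc L e b′ → b ≡ b′
  roots-agree v fl Sb Sb′ ε ε = refl
  roots-agree v fl Sb Sb′ ε (l ◅ _) = ⊥-elim (proj₂ (proj₂ (Flow.av fl l)) (proj₁ (v Sb)))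
  roots-agree v fl Sb Sb′ (l ◅ _) ε = ⊥-elim (proj₂ (proj₂ (Flow.av fl l)) (proj₁ (v Sb′)))
  roots-agree v fl Sb Sb′ (l ◅ p) (l′ ◅ p′) with Flow.fun fl l l′
  ... | refl = roots-agree v fl Sb Sb′ p p′

  -- P b e says that e lies on the part of the path of b that is not in the flow L.
  Done : Succ → Succ → A → Set
  Done L P b = Σ A λ c → Anc L c b × Σ (List A) λ p → IsWalk D (head c) p t × All (P b) p

  Tails : Succ → Pred A 0ℓ
  Tails P e = Σ A λ b → P b e

  record System (Γ : Web) : Set₁ where
    field
      L     : Succ
      P     : Succ
      flow  : Flow Γ L
      P-new : ∀ {b e} → P b e → Avail Γ e × ¬ Used L e
      P-own : ∀ {b b′ e} → P b e → P b′ e → b ≡ b′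
      ind   : Ind (N Γ) (Used L ∪ Tails P)
      done  : ∀ {b} → S Γ b → Done L P b

  module LinkAll {Γ : Web} (validΓ : Valid Γ) (looseΓ : Loose Γ) (t∈XΓ : X Γ t) where

    record State : Set₁ where
      field
        Γ′    : Web
        L     : Succ
        P     : Succ
        flow  : Flow Γ L
        ahead : Ahead Γ L Γ′
        valid : Valid Γ′
        t∈X   : X Γ′ t
        loose : Loose Γ′
        P⊆N   : ∀ {b e} → P b e → N Γ′ e
        P-new : ∀ {b e} → P b e → Avail Γ e × ¬ Used L e
        P-own : ∀ {b b′ e} → P b e → P b′ e → b ≡ b′
        ind   : Ind (N Γ) (Used L ∪ Tails P)
        track : ∀ {b} → S Γ b → (Σ A λ c → S Γ′ c × Anc L c b) ⊎ Done L P b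
    open State

    initial : State
    initial = record
      { Γ′ = Γ ; L = λ _ _ → ⊥ ; P = λ _ _ → ⊥
      ; flow = Wave.flow wave-∅
      ; ahead = record { X⊆ = id ; N⊆ = id ; L⊆N = λ () ; S⊆ = inj₁ ; L∩X = λ () }
      ; valid = validΓ ; t∈X = t∈XΓ ; loose = looseΓ
      ; P⊆N = λ () ; P-new = λ () ; P-own = λ ()
      ; ind = λ { (inj₁ ()) ; (inj₂ ()) }
      ; track = λ s → inj₁ (_ , s , ε)
      }

    module Link (σ : State) {b c : A} (Sb : S Γ b) (Sc : S (Γ′ σ) c) (c→b : Anc (L σ) c b) where
      open Linked (Tree.linked (valid σ) (loose σ) (t∈X σ) Sc)
        using (Q; Q⊆N; Q-new; carry; path; walk; path⊆)
        renaming (Γ′ to Γ⁺; L to U; flow to flowU; ahead to aheadU; valid to valid⁺; t∈X to t∈X⁺;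
                  loose to loose⁺; ind to indU)

      L⁺ P⁺ : Succ
      L⁺ = L σ ∪ˢ U
      P⁺ b′ e = P σ b′ e ⊎ (b ≡ b′ × Q e)

      done-b : Done L⁺ P⁺ b
      done-b = c , Star.map inj₁ c→b , path , walk , All.map (λ q → inj₂ (refl , q)) path⊆

      next : State
      next = record
        { Γ′ = Γ⁺ ; L = L⁺ ; P = P⁺
        ; flow = flow-∪ (flow σ) (ahead σ) flowU
        ; ahead = ahead-∪ (ahead σ) aheadU
        ; valid = valid⁺ ; t∈X = t∈X⁺ ; loose = loose⁺
        ; P⊆N = λ { (inj₁ p) → Ahead.N⊆ aheadU (P⊆N σ p) ; (inj₂ (_ , q)) → Q⊆N q }
        ; P-new = new
        ; P-own = λ { (inj₁ p) (inj₁ p′) → P-own σ p p′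
                    ; (inj₁ p) (inj₂ (_ , q)) → ⊥-elim (proj₂ (proj₂ (proj₁ (Q-new q))) (P⊆N σ p))
                    ; (inj₂ (_ , q)) (inj₁ p) → ⊥-elim (proj₂ (proj₂ (proj₁ (Q-new q))) (P⊆N σ p))
                    ; (inj₂ (refl , _)) (inj₂ (refl , _)) → refl }
        ; ind = ind-anti id split (ind-∪ (ind σ) (ind-anti base id indU))
        ; track = track⁺
        }
        where
        new : ∀ {b′ e} → P⁺ b′ e → Avail Γ e × ¬ Used L⁺ e
        new (inj₁ p) = proj₁ (P-new σ p) ,
          λ { (d , inj₁ l) → proj₂ (P-new σ p) (d , l)
            ; (d , inj₂ u) → proj₂ (proj₂ (Flow.av flowU u)) (P⊆N σ p) }
        new (inj₂ (_ , q)) = Ahead.avail (ahead σ) (proj₁ (Q-new q)) ,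
          λ { (d , inj₁ l) → proj₂ (proj₂ (proj₁ (Q-new q))) (Ahead.L⊆N (ahead σ) (d , l))
            ; (d , inj₂ u) → proj₂ (Q-new q) (d , u) }
        base : N Γ ∪ (Used (L σ) ∪ Tails (P σ)) ⊆ N (Γ′ σ)
        base (inj₁ n) = Ahead.N⊆ (ahead σ) n
        base (inj₂ (inj₁ u)) = Ahead.L⊆N (ahead σ) u
        base (inj₂ (inj₂ (_ , p))) = P⊆N σ p
        split : Used L⁺ ∪ Tails P⁺ ⊆ (Used (L σ) ∪ Tails (P σ)) ∪ (Used U ∪ Q)
        split (inj₁ (d , inj₁ l)) = inj₁ (inj₁ (d , l))
        split (inj₁ (d , inj₂ u)) = inj₂ (inj₁ (d , u))
        split (inj₂ (b′ , inj₁ p)) = inj₁ (inj₂ (b′ , p))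
        split (inj₂ (b′ , inj₂ (_ , q))) = inj₂ (inj₂ q)
        track⁺ : ∀ {b′} → S Γ b′ → (Σ A λ d → S Γ⁺ d × Anc L⁺ d b′) ⊎ Done L⁺ P⁺ b′
        track⁺ Sb′ with track σ Sb′
        ... | inj₂ (d , a , p , w , all) = inj₂ (d , Star.map inj₁ a , p , w , All.map inj₁ all)
        ... | inj₁ (d , Sd , a) with em {c ≡ d}
        -- Tracing `c` back leads to only one token of `Γ`, so a token currently represented by `c`
        -- is `b` itself.
        ... | yes refl with roots-agree validΓ (flow σ) Sb Sb′ c→b a
        ... | refl = inj₂ done-b
        track⁺ Sb′ | inj₁ (d , Sd , a) | no c≢d =
          let d′ , Sd′ , a′ = carry Sd c≢d in inj₁ (d′ , Sd′ , Star.map inj₂ a′ ◅◅ Star.map inj₁ a)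

    Pending : ℕ → State → Set
    Pending n σ = Σ A λ b → proj₁ countA b ≡ n × S Γ b × Σ A λ c → S (Γ′ σ) c × Anc (L σ) c b

    step-with : ∀ {n} σ → Dec (Pending n σ) → State
    step-with σ (yes (_ , _ , Sb , _ , Sc , a)) = Link.next σ Sb Sc a
    step-with σ (no _) = σ

    step : ℕ → State → State
    step n σ = step-with σ (em {Pending n σ})

    -- Step `n` links the token coded `n` from wherever earlier steps have carried it, unless it is
    -- finished.
    stage : ℕ → State
    stage zero = initial
    stage (suc n) = step n (stage n)

    step-L : ∀ n σ {c f} → L σ c f → L (step n σ) c f
    step-L n σ l with em {Pending n σ}
    ... | yes _ = inj₁ l
    ... | no _ = l

    step-P : ∀ n σ {b e} → P σ b e → P (step n σ) b e
    step-P n σ p with em {Pending n σ}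
    ... | yes _ = inj₁ p
    ... | no _ = p

    step-done : ∀ σ {b} → S Γ b → Done (L (step (proj₁ countA b) σ)) (P (step (proj₁ countA b) σ)) b
    step-done σ {b} Sb with em {Pending (proj₁ countA b) σ}
    ... | yes (b′ , eq , Sb′ , c , Sc , a) with proj₂ countA eq
    ... | refl = Link.done-b σ Sb′ Sc a
    step-done σ {b} Sb | no none with track σ Sb
    ... | inj₁ (c , Sc , a) = ⊥-elim (none (b , refl , Sb , c , Sc , a))
    ... | inj₂ d = d

    system : System Γ
    system = record
      { L = λ c f → Σ ℕ λ n → L (stage n) c f
      ; P = λ b e → Σ ℕ λ n → P (stage n) b e
      ; flow = flow-limit (λ n → L (stage n)) (λ n → step-L n (stage n)) (λ n → flow (stage n))
      ; P-new = λ { (m , p) → proj₁ (P-new (stage m) p) ,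
          λ { (c , n , l) → proj₂ (P-new (stage (m ⊔ n)) (upP (m≤m⊔n m n) p)) (c , upL (m≤n⊔m m n) l) } }
      ; P-own = λ { (m , p) (n , p′) →
          P-own (stage (m ⊔ n)) (upP (m≤m⊔n m n) p) (upP (m≤n⊔m m n) p′) }
      ; ind = ind-anti id
          (λ { (inj₁ (c , n , l)) → n , inj₁ (c , l) ; (inj₂ (b , n , p)) → n , inj₂ (b , p) })
          (ind-limit (λ n → Used (L (stage n)) ∪ Tails (P (stage n)))
            (λ n → λ { (inj₁ (c , l)) → inj₁ (c , step-L n (stage n) l)
                     ; (inj₂ (b , p)) → inj₂ (b , step-P n (stage n) p) })
            (λ n → ind (stage n)))
      ; done = λ {b} Sb → let n = proj₁ countA b
                              c , a , p , w , all = step-done (stage n) Sb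
                          in c , Star.map (suc n ,_) a , p , w , All.map (suc n ,_) all
      }
      where
      upL : ∀ {m n} → m ≤ n → ∀ {c f} → L (stage m) c f → L (stage n) c f
      upL = succ-mono (λ n → L (stage n)) (λ n → step-L n (stage n))
      upP : ∀ {m n} → m ≤ n → ∀ {c f} → P (stage m) c f → P (stage n) c f
      upP = succ-mono (λ n → P (stage n)) (λ n → step-P n (stage n))

-- Shortening walks to paths

module Walks (em : ExcludedMiddle 0ℓ) (D : Digraph) where
  open Digraph D

  suffix : ∀ {u v w es} → IsWalk D v es w → Unique (verts D v es) → u ∈ˡ verts D v es →
           Σ (List A) λ fs → IsWalk D u fs w × Unique (verts D u fs) × (∀ {x} → x ∈ˡ fs → x ∈ˡ es)
  suffix nil uq (here refl) = [] , nil , uq , id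
  suffix {es = es} p@(cons _ _) uq (here refl) = es , p , uq , id
  suffix (cons _ p) (_ ∷ uq) (there i) =
    let fs , q , uq′ , sub = suffix p uq i in fs , q , uq′ , there ∘ sub

  shorten : ∀ {u w es} → IsWalk D u es w →
            Σ (List A) λ fs → IsWalk D u fs w × Unique (verts D u fs) × (∀ {x} → x ∈ˡ fs → x ∈ˡ es)
  shorten nil = [] , nil , ([] ∷ []) , id
  shorten {u} (cons {e = e} h p) with shorten p
  ... | fs , q , uq , sub with em {u ∈ˡ verts D (head e) fs}
  ... | yes i = let fs′ , q′ , uq′ , sub′ = suffix q uq i in fs′ , q′ , uq′ , there ∘ sub ∘ sub′
  ... | no ∉ = e ∷ fs , cons h q , ¬Any⇒All¬ _ ∉ ∷ uq , λ { (here r) → here r ; (there i) → there (sub i) }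

  crossing : ∀ {u w es} (Z : Pred V 0ℓ) → IsWalk D u es w → ¬ Z u → Z w →
             Σ A λ e → e ∈ˡ es × ¬ Z (tail e) × Z (head e)
  crossing Z nil ¬u w = ⊥-elim (¬u w)
  crossing Z (cons {e = e} refl p) ¬u w with em {Z (head e)}
  ... | yes z = e , here refl , ¬u , z
  ... | no ¬z = let f , i , ¬t , h = crossing Z p ¬z w in f , there i , ¬t , h

-- Assembling the paths and the separating set

module Main (em : ExcludedMiddle 0ℓ) (D : Digraph) (countV : Countable (Digraph.V D)) (countA : Countable (Digraph.A D))
          (s t : Digraph.V D) (s≢t : s ≢ t)
          (M : (v : Digraph.V D) → Matroid (InEdge D v)) (finM : (v : Digraph.V D) → Finitary (M v)) where
  open Digraph D
  module Sum = DirectSum em D M finM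
  open Closure Sum.closure
  open Independence em Sum.closure
  open Webs em D countV countA t Sum.closure Sum.local
  open Walks em D
  open Web

  -- Paths start with arcs of `I`, which serve as tokens and are contracted from the outset. Loops
  -- at `s` are excluded because a token must end in the vertex set of the web.
  Out I : Pred A 0ℓ
  Out e = tail e ≡ s × head e ≢ s
  I = Sum.basis Out

  Γₛ : Web
  Γₛ = record { X = λ v → v ≢ s ; S = I ; N = I }

  validₛ : Valid Γₛ
  validₛ i = i , proj₂ (Sum.basis⊆ i)

  module Assembly {L₀ : Succ} {Y : Pred V 0ℓ} (wave : Wave Γₛ L₀ Y) (system : System (quot Γₛ L₀ Y)) where
    module W₀ = Wave wave
    open System system

    Γ₀ : Web
    Γ₀ = quot Γₛ L₀ Y

    valid₀ : Valid Γ₀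
    valid₀ = quot-valid {Γₛ} {L₀} {Y} validₛ W₀.flow

    Z : Pred V 0ℓ
    Z = X Γ₀

    t∈Z : Z t
    t∈Z = s≢t ∘ sym , W₀.t∈Y

    final : ∀ {c} → Z (head c) → ∀ {f} → ¬ L₀ c f
    final z l = W₀.out l (subst Y (W₀.link l) (proj₂ z))

    forward : ∀ {b e} → Anc L₀ b e → Star L₀ e b
    forward = Star.reverse id

    -- Following `L₀` forward is deterministic and must stop at the first arc that ends in `Z`.
    forward-final : ∀ {b b′ e} → Z (head b) → Z (head b′) → Star L₀ e b → Star L₀ e b′ → b ≡ b′
    forward-final z z′ ε ε = refl
    forward-final z z′ ε (l ◅ _) = ⊥-elim (final z l)
    forward-final z z′ (l ◅ _) ε = ⊥-elim (final z′ l)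
    forward-final z z′ (l ◅ p) (l′ ◅ p′) with W₀.inj l l′
    ... | refl = forward-final z z′ p p′

    before : ∀ {b e} → I b ⊎ Used L₀ b → Anc L₀ b e → N Γ₀ e
    before n ε = n
    before n (l ◅ p) = before (W₀.source l) p

    -- e lies on the path of the token b: before b, between b and the end of its trail in L, or after it.
    Own : A → A → Set
    Own b e = Anc L₀ b e ⊎ (Used L e × Anc L e b) ⊎ P b e

    own-unique : ∀ {b b′ e} → S Γ₀ b → S Γ₀ b′ → Own b e → Own b′ e → b ≡ b′
    own-unique Sb Sb′ (inj₁ p) (inj₁ p′) =
      forward-final (proj₂ (valid₀ Sb)) (proj₂ (valid₀ Sb′)) (forward p) (forward p′)
    own-unique Sb Sb′ (inj₁ p) (inj₂ (inj₁ ((_ , l) , _))) =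
      ⊥-elim (proj₂ (proj₂ (Flow.av flow l)) (before (proj₁ Sb) p))
    own-unique Sb Sb′ (inj₁ p) (inj₂ (inj₂ q)) =
      ⊥-elim (proj₂ (proj₂ (proj₁ (P-new q))) (before (proj₁ Sb) p))
    own-unique Sb Sb′ (inj₂ (inj₁ ((_ , l) , _))) (inj₁ p) =
      ⊥-elim (proj₂ (proj₂ (Flow.av flow l)) (before (proj₁ Sb′) p))
    own-unique Sb Sb′ (inj₂ (inj₂ q)) (inj₁ p) =
      ⊥-elim (proj₂ (proj₂ (proj₁ (P-new q))) (before (proj₁ Sb′) p))
    own-unique Sb Sb′ (inj₂ (inj₁ (_ , a))) (inj₂ (inj₁ (_ , a′))) = roots-agree valid₀ flow Sb Sb′ a a′
    own-unique Sb Sb′ (inj₂ (inj₁ (u , _))) (inj₂ (inj₂ q)) = ⊥-elim (proj₂ (P-new q) u)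
    own-unique Sb Sb′ (inj₂ (inj₂ q)) (inj₂ (inj₁ (u , _))) = ⊥-elim (proj₂ (P-new q) u)
    own-unique Sb Sb′ (inj₂ (inj₂ q)) (inj₂ (inj₂ q′)) = P-own q q′

    own-later : ∀ {b e} → Own b e → Anc L₀ b e ⊎ Avail Γ₀ e
    own-later (inj₁ p) = inj₁ p
    own-later (inj₂ (inj₁ ((_ , l) , _))) = inj₂ (Flow.av flow l)
    own-later (inj₂ (inj₂ q)) = inj₂ (proj₁ (P-new q))

    trail : ∀ {Γ L b c} → Flow Γ L → Anc L c b → Σ (List A) λ es →
            IsWalk D (head b) es (head c) × All (λ e → Used L e × Anc L c e × Anc L e b) es
    trail fl ε = [] , nil , []
    trail fl (_◅_ {i = c} {j = d} l p) =
      let es , w , all = trail fl p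
      in es ∷ʳ c , walk-∷ʳ (subst (IsWalk D _ es) (Flow.link fl l) w) ,
         ∷ʳ⁺ (All.map (λ { (u , q , r) → u , l ◅ q , r }) all) ((d , l) , ε , l ◅ p)

    initial-root : ∀ {b} → I b ⊎ Used L₀ b → Σ A λ i → I i × Anc L₀ b i
    initial-root (inj₁ i) = _ , i , ε
    initial-root (inj₂ (_ , l)) = let i , Ii , p = W₀.root l in i , Ii , l ◅ p

    walk-of : ∀ {b} → S Γ₀ b → Σ (List A) λ es → IsWalk D s es t × All (Own b) es
    walk-of Sb =
      let i , Ii , b→i = initial-root (proj₁ Sb)
          c , c→b , p₃ , w₃ , all₃ = done Sb
          p₁ , w₁ , all₁ = trail W₀.flow b→i
          p₂ , w₂ , all₂ = trail flow c→b
      in i ∷ p₁ ++ p₂ ++ p₃ ,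
         cons (proj₁ (Sum.basis⊆ Ii)) (walk-++ w₁ (walk-++ w₂ w₃)) ,
         inj₁ b→i ∷ ++⁺ (All.map (λ { (_ , q , _) → inj₁ q }) all₁)
           (++⁺ (All.map (λ { (u , _ , q) → inj₂ (inj₁ (u , q)) }) all₂) (All.map (inj₂ ∘ inj₂) all₃))

    abstract
      own-path : ∀ {b} → S Γ₀ b → Σ (Path D s t) λ p → ∀ {e} → e ∈ˡ edges D p → Own b e
      own-path Sb =
        let _ , w , all = walk-of Sb
            fs , w′ , uq , sub = shorten w
        in (fs , w′ , uq) , λ i → All.lookup all (sub i)

    path-of : ∀ {b} → S Γ₀ b → Path D s t
    path-of Sb = proj₁ (own-path Sb)

    path-own : ∀ {b} (Sb : S Γ₀ b) {e} → e ∈ˡ edges D (path-of Sb) → Own b e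
    path-own Sb = proj₂ (own-path Sb)

    -- The membership proof returned by em is the canonical one, so each token has a single path.
    Paths : Pred (Path D s t) 0ℓ
    Paths p = Σ A λ b → Σ (S Γ₀ b) λ Sb → em {S Γ₀ b} ≡ yes Sb × p ≡ path-of Sb

    canonical : ∀ {b} → S Γ₀ b → Σ (S Γ₀ b) λ Sb → em {S Γ₀ b} ≡ yes Sb
    canonical {b} Sb with em {S Γ₀ b}
    ... | yes Sb′ = Sb′ , refl
    ... | no ¬Sb = ⊥-elim (¬Sb Sb)

    arc-own : ∀ {e} → ArcsOf D Paths e → Σ A λ b → S Γ₀ b × Own b e
    arc-own (_ , (b , Sb , _ , refl) , i) = b , Sb , path-own Sb i

    disjoint : EdgeDisjoint D Paths
    disjoint _ _ (b , Sb , eq , refl) (b′ , Sb′ , eq′ , refl) (e , i , i′)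
      with own-unique Sb Sb′ (path-own Sb i) (path-own Sb′ i′)
    ... | refl with trans (sym eq) eq′
    ... | refl = refl

    ind-all : Ind ∅ ((I ∪ Used L₀) ∪ (Used L ∪ Tails P))
    ind-all = ind-∪ (ind-∪ (λ {f} b h → Sum.basis-indep b (mono (none (I ∖ ｛ f ｝)) h))
                       (ind-anti (none I) id W₀.ind)) (ind-anti (none (I ∪ Used L₀)) id ind)
      where
      none : ∀ (F : Pred A 0ℓ) → ∅ ∪ F ⊆ F
      none F (inj₂ x) = x

    independent : DirectSumIndep D M (ArcsOf D Paths)
    independent = Sum.indep λ a h → ind-all (all a) (mono (λ { (x , n) → inj₂ (all x , n) }) h)
      where
      all : ArcsOf D Paths ⊆ (I ∪ Used L₀) ∪ (Used L ∪ Tails P)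
      all a with arc-own a
      ... | b , Sb , inj₁ p = inj₁ (before (proj₁ Sb) p)
      ... | b , Sb , inj₂ (inj₁ (u , _)) = inj₂ (inj₁ u)
      ... | b , Sb , inj₂ (inj₂ q) = inj₂ (inj₂ (b , q))

    old-tail : ∀ {e} → N Γ₀ e → ¬ Z (tail e)
    old-tail (inj₁ i) (n , _) = n (proj₁ (Sum.basis⊆ i))
    old-tail (inj₂ (_ , l)) (_ , y) = W₀.out l y

    -- Up to and including the token, the arcs of a path start outside `Z`; all later ones belong to
    -- the web on `Z` and end inside it.
    no-exit : ∀ e → ArcsOf D Paths e → ¬ outD D Z e
    no-exit e a (zt , ¬zh) with arc-own a
    ... | b , Sb , o with own-later o
    ... | inj₁ p = old-tail (before (proj₁ Sb) p) zt
    ... | inj₂ (_ , zh , _) = ¬zh zh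

    -- The path of c enters Z, and the only arc of it that can do so is c.
    entry : ∀ {c} → N Γ₀ c → Z (head c) → (ArcsOf D Paths ∩ inD D Z) c
    entry {c} n z with canonical {c} (n , proj₂ z)
    ... | Sc , eq with crossing Z (proj₁ (proj₂ (path-of Sc))) (λ z → proj₁ z refl) t∈Z
    ... | e , i , ¬zt , zh with own-later (path-own Sc i)
    ... | inj₂ (zt , _) = ⊥-elim (¬zt zt)
    ... | inj₁ p with forward-final z zh (forward p) ε
    ... | refl = (path-of Sc , (c , Sc , eq , refl) , i) , ¬zt , zh

    -- Arcs from `s` are not in the web and are spanned by the basis `I`; other entering arcs lie in
    -- `I` or are spanned through the wave.
    enters-spanned : inD D Z ⊆ cl (I ∪ Used L₀)
    enters-spanned {e} (¬zt , n , y) with em {tail e ≡ s} | em {I e}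
    ... | yes t≡s | _ = mono inj₁ (Sum.⊆cl-basis (t≡s , n))
    ... | no _ | yes i = ext (inj₁ i)
    ... | no t≢s | no ¬i = W₀.spans (t≢s , n , ¬i) (λ y → ¬zt (t≢s , y)) y

    -- By `local` only those arcs of `I ∪ Used L₀` count that share their head with `e`. They end in
    -- `Z`, so by `entry` each lies on a path and enters `Z`.
    spanning : Spans (DirectSumIndep D M) (ArcsOf D Paths ∩ inD D Z) (inD D Z)
    spanning {e} i = Sum.cl⇒span (mono (λ { (n , q) → entry n (subst Z (sym q) (proj₂ i)) }) (Sum.local (enters-spanned i)))

  module W = Maximal Γₛ

  system₀ : System (quot Γₛ W.L∞ W.Y∞)
  system₀ = LinkAll.system (quot-valid {Γₛ} {W.L∞} {W.Y∞} validₛ (Wave.flow W.wave)) W.loose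
              (s≢t ∘ sym , Wave.t∈Y W.wave)

  open Assembly W.wave system₀ public

theorem5 : ExcludedMiddle 0ℓ →
  (D : Digraph) → Countable (Digraph.V D) → Countable (Digraph.A D) →
  (s t : Digraph.V D) → s ≢ t →
  (M : (v : Digraph.V D) → Matroid (InEdge D v)) → ((v : Digraph.V D) → Finitary (M v)) →
  Σ (Pred (Path D s t) 0ℓ) (λ P → Σ (Pred (Digraph.V D) 0ℓ) (λ X →
  EdgeDisjoint D P
  × DirectSumIndep D M (ArcsOf D P)
  × t ∈ X × ¬ (s ∈ X)
  × (∀ e → e ∈ ArcsOf D P → ¬ (e ∈ outD D X))
  × Spans (DirectSumIndep D M) (ArcsOf D P ∩ inD D X) (inD D X)))
theorem5 em D countV countA s t s≢t M finM =
  Paths , Z , disjoint , independent , t∈Z , (λ z → proj₁ z refl) , no-exit , spanning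
  where open Main em D countV countA s t s≢t M finM
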